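{- The class $\mathbb{DT}^s$ is properly learnable under the uniform distribution on $\{0,1\}^n$ using $O\big(\tfrac1\epsilon\, s\log n\log\tfrac1\delta\big)$ random example queries in time $\big(\tfrac{s}{\epsilon}\log n\big)^{O(\log n)}\log\tfrac1\delta$: i.e., for every $f\in\mathbb{DT}^s$, with probability at least $1-\delta$ the algorithm outputs $h\in\mathbb{DT}^s$ with $\Pr_{x\text{ uniform}}[h(x)\ne f(x)]\le\epsilon$.
   Context: A decision tree over $x_1,\dots,x_n$ is a rooted binary tree whose internal nodes are labeled by variables, each having a 0-child and a 1-child, leaves labeled $0$ or $1$; it computes a Boolean function by following from the root the $x_i$-child at a node labeled $x_i$. Size = number of leaves. $\mathbb{DT}^s$ is the class of functions computed by decision trees of size at most $s$. A random example query returns $(x,f(x))$ with $x$ uniform in $\{0,1\}^n$. -}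

module Defs where

open import Data.Bool using (Bool; true; false; if_then_else_)
import Data.Bool.Properties as Bool
open import Data.Fin using (Fin; toℕ)
open import Data.Integer using (∣_∣; +_)
open import Data.List using (List; []; _∷_; allFin)
open import Data.List.Membership.Propositional using (_∈_)
open import Data.List.Relation.Unary.All using (All; []; _∷_; lookup)
open import Data.Nat using (ℕ; zero; suc; _⊔_)
import Data.Nat as ℕ
open import Data.Nat.Logarithm using (⌈log₂_⌉)
open import Data.Product using (_×_; _,_; proj₁; proj₂; ∃-syntax)
open import Data.Rational using (ℚ; 0ℚ; 1ℚ; ½; _+_; _*_; 1/_; _/_; ceiling; ↥_; ↧ₙ_; Positive; +-*-rawSemiring)
import Data.Rational as ℚ
import Data.Rational.Properties as ℚ
open import Data.Unit using (⊤; tt)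
open import Data.Vec using (Vec; []; _∷_)
import Data.Vec as Vec
open import Function using (_∘_)
open import Relation.Binary.PropositionalEquality using (_≗_)
open import Relation.Nullary using (Dec; does; ¬?)
open import Relation.Nullary.Decidable using (_×-dec_)
open import Relation.Unary using (Pred; Decidable)
open import Algebra.Definitions.RawSemiring +-*-rawSemiring using (_^_) public

------------------------------------------------------------------------
-- Boolean functions and decision trees

Point : ℕ → Set
Point n = Vec Bool n

data DT (n : ℕ) : Set where
  leaf : Bool → DT n
  node : (i : Fin n) (t₀ t₁ : DT n) → DT n

compute : ∀ {n} → DT n → Point n → Bool
compute (leaf b)       x = b
compute (node i t₀ t₁) x = if Vec.lookup x i then compute t₁ x else compute t₀ x

size : ∀ {n} → DT n → ℕ
size (leaf b)       = 1
size (node i t₀ t₁) = size t₀ ℕ.+ size t₁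

_∈DT^_ : ∀ {n} → (Point n → Bool) → ℕ → Set
f ∈DT^ s = ∃[ t ] size t ℕ.≤ s × compute t ≗ f

------------------------------------------------------------------------
-- The uniform distribution on {0,1}ⁿ

-- Expectation over n independent fair bits, i.e. 2⁻ⁿ times the sum of g over
-- all points.
𝔼 : ∀ {n} → (Point n → ℚ) → ℚ
𝔼 {zero}  g = g []
𝔼 {suc n} g = ½ * (𝔼 (g ∘ (false ∷_)) + 𝔼 (g ∘ (true ∷_)))

indicator : ∀ {p} {P : Set p} → Dec P → ℚ
indicator P? = if does P? then 1ℚ else 0ℚ

Pr-uniform : ∀ {n p} {P : Pred (Point n) p} → Decidable P → ℚ
Pr-uniform P? = 𝔼 (λ x → indicator (P? x))

error : ∀ {n} → (h f : Point n → Bool) → ℚ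
error h f = Pr-uniform (λ x → ¬? (h x Bool.≟ f x))

------------------------------------------------------------------------
-- Computations with access to random points

-- 'stop c a' ends with result a, c being the total running time along the
-- path that leads to it; 'draw' continues with a fresh uniform point.
data Run (n : ℕ) (A : Set) : Set where
  stop : (time : ℕ) → A → Run n A
  draw : (Point n → Run n A) → Run n A

module _ {n : ℕ} where

  delay : ∀ {A} → ℕ → Run n A → Run n A
  delay c (stop d a) = stop (c ℕ.+ d) a
  delay c (draw k)   = draw (λ x → delay c (k x))

  tick : ∀ {A} → Run n A → Run n A
  tick = delay 1

  return : ∀ {A} → A → Run n A
  return = stop 0

  infixl 1 _>>=_
  _>>=_ : ∀ {A B} → Run n A → (A → Run n B) → Run n B
  stop c a >>= g = delay c (g a)
  draw k   >>= g = draw (λ x → k x >>= g)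

  -- Number of queries and running time when the drawn points are ω 0, ω 1, …
  queries : ∀ {A} → Run n A → (ℕ → Point n) → ℕ
  queries (stop c a) ω = 0
  queries (draw k)   ω = suc (queries (k (ω 0)) (ω ∘ suc))

  time : ∀ {A} → Run n A → (ℕ → Point n) → ℕ
  time (stop c a) ω = c
  time (draw k)   ω = time (k (ω 0)) (ω ∘ suc)

  Pr : ∀ {A p} {P : Pred A p} → Run n A → Decidable P → ℚ
  Pr (stop c a) P? = indicator (P? a)
  Pr (draw k)   P? = 𝔼 (λ x → Pr (k x) P?)

------------------------------------------------------------------------
-- Algorithms

-- Algorithms are programs of a call-by-value functional language.  A program
-- is a single piece of syntax, independent of n, s, ε and δ.  Every evaluation
-- step costs one unit and is a constant-time operation on a random-access
-- machine with unit-cost addition, truncated subtraction and comparison of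
-- numbers (there is no multiplication).

infixr 5 _`⇒_
infixr 6 _`×_

data Ty : Set where
  `unit `bool `nat `var `point `tree : Ty
  `list     : Ty → Ty
  _`×_ _`⇒_ : Ty → Ty → Ty

Ctx : Set
Ctx = List Ty

infix  4 _⊢_
infixl 7 _·_

-- The recursors are lazy: a recursive call is passed to the step as a thunk,
-- so that only the calls which are forced take place and are paid for.
data _⊢_ (Γ : Ctx) : Ty → Set where
  var     : ∀ {a} → a ∈ Γ → Γ ⊢ a
  lam     : ∀ {a b} → a ∷ Γ ⊢ b → Γ ⊢ a `⇒ b
  _·_     : ∀ {a b} → Γ ⊢ a `⇒ b → Γ ⊢ a → Γ ⊢ b
  unit    : Γ ⊢ `unit
  bool    : Bool → Γ ⊢ `bool
  ifte    : ∀ {a} → Γ ⊢ `bool → Γ ⊢ a → Γ ⊢ a → Γ ⊢ a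
  lit     : ℕ → Γ ⊢ `nat
  add sub : Γ ⊢ `nat → Γ ⊢ `nat → Γ ⊢ `nat
  leq     : Γ ⊢ `nat → Γ ⊢ `nat → Γ ⊢ `bool
  natrec  : ∀ {a} → Γ ⊢ a → `nat ∷ (`unit `⇒ a) ∷ Γ ⊢ a → Γ ⊢ `nat → Γ ⊢ a
  pair    : ∀ {a b} → Γ ⊢ a → Γ ⊢ b → Γ ⊢ a `× b
  fst     : ∀ {a b} → Γ ⊢ a `× b → Γ ⊢ a
  snd     : ∀ {a b} → Γ ⊢ a `× b → Γ ⊢ b
  nil     : ∀ {a} → Γ ⊢ `list a
  cons    : ∀ {a} → Γ ⊢ a → Γ ⊢ `list a → Γ ⊢ `list a
  listrec : ∀ {a b} → Γ ⊢ b → a ∷ `list a ∷ (`unit `⇒ b) ∷ Γ ⊢ b →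
            Γ ⊢ `list a → Γ ⊢ b
  index   : Γ ⊢ `var → Γ ⊢ `nat
  bit     : Γ ⊢ `point → Γ ⊢ `var → Γ ⊢ `bool
  leaf    : Γ ⊢ `bool → Γ ⊢ `tree
  node    : Γ ⊢ `var → Γ ⊢ `tree → Γ ⊢ `tree → Γ ⊢ `tree
  treerec : ∀ {a} → `bool ∷ Γ ⊢ a →
            `var ∷ `tree ∷ `tree ∷ (`unit `⇒ a) ∷ (`unit `⇒ a) ∷ Γ ⊢ a →
            Γ ⊢ `tree → Γ ⊢ a
  example : Γ ⊢ `point `× `bool

Val : ℕ → Ty → Set
Val n `unit     = ⊤
Val n `bool     = Bool
Val n `nat      = ℕ
Val n `var      = Fin n
Val n `point    = Point n
Val n `tree     = DT n
Val n (`list a) = List (Val n a)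
Val n (a `× b)  = Val n a × Val n b
Val n (a `⇒ b)  = Val n a → Run n (Val n b)

Env : ℕ → Ctx → Set
Env n = All (Val n)

module _ {n : ℕ} where

  natRec : ∀ {A} → Run n A → (ℕ → (⊤ → Run n A) → Run n A) → ℕ → Run n A
  natRec z s zero    = tick z
  natRec z s (suc m) = tick (s m (λ _ → natRec z s m))

  listRec : ∀ {A B : Set} → Run n B →
            (A → List A → (⊤ → Run n B) → Run n B) → List A → Run n B
  listRec z s []       = tick z
  listRec z s (x ∷ xs) = tick (s x xs (λ _ → listRec z s xs))

  treeRec : ∀ {A} → (Bool → Run n A) →
            (Fin n → DT n → DT n → (⊤ → Run n A) → (⊤ → Run n A) → Run n A) →
            DT n → Run n A
  treeRec l s (leaf b)       = tick (l b)
  treeRec l s (node i t₀ t₁) =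
    tick (s i t₀ t₁ (λ _ → treeRec l s t₀) (λ _ → treeRec l s t₁))

-- The argument f is the target function, which a program can access only
-- through 'example'; writing down an example is charged n + 1.
eval : ∀ {n Γ a} → (f : Point n → Bool) → Γ ⊢ a → Env n Γ → Run n (Val n a)
eval f (var x)         ρ = tick (return (lookup ρ x))
eval f (lam t)         ρ = tick (return (λ v → eval f t (v ∷ ρ)))
eval f (t · u)         ρ = tick (eval f t ρ >>= λ g → eval f u ρ >>= g)
eval f unit            ρ = tick (return tt)
eval f (bool b)        ρ = tick (return b)
eval f (ifte t u v)    ρ = tick (eval f t ρ >>= λ b →
                                 if b then eval f u ρ else eval f v ρ)
eval f (lit k)         ρ = tick (return k)
eval f (add t u)       ρ = tick (eval f t ρ >>= λ k → eval f u ρ >>= λ l →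
                                 return (k ℕ.+ l))
eval f (sub t u)       ρ = tick (eval f t ρ >>= λ k → eval f u ρ >>= λ l →
                                 return (k ℕ.∸ l))
eval f (leq t u)       ρ = tick (eval f t ρ >>= λ k → eval f u ρ >>= λ l →
                                 return (k ℕ.≤ᵇ l))
eval f (natrec z s t)  ρ = tick (eval f t ρ >>= natRec
                                 (eval f z ρ)
                                 (λ m r → eval f s (m ∷ r ∷ ρ)))
eval f (pair t u)      ρ = tick (eval f t ρ >>= λ v → eval f u ρ >>= λ w →
                                 return (v , w))
eval f (fst t)         ρ = tick (eval f t ρ >>= λ p → return (proj₁ p))
eval f (snd t)         ρ = tick (eval f t ρ >>= λ p → return (proj₂ p))
eval f nil             ρ = tick (return [])
eval f (cons t u)      ρ = tick (eval f t ρ >>= λ v → eval f u ρ >>= λ vs →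
                                 return (v ∷ vs))
eval f (listrec z s t) ρ = tick (eval f t ρ >>= listRec
                                 (eval f z ρ)
                                 (λ v vs r → eval f s (v ∷ vs ∷ r ∷ ρ)))
eval f (index t)       ρ = tick (eval f t ρ >>= λ i → return (toℕ i))
eval f (bit t u)       ρ = tick (eval f t ρ >>= λ x → eval f u ρ >>= λ i →
                                 return (Vec.lookup x i))
eval f (leaf t)        ρ = tick (eval f t ρ >>= λ b → return (leaf b))
eval f (node t u v)    ρ = tick (eval f t ρ >>= λ i → eval f u ρ >>= λ t₀ →
                                 eval f v ρ >>= λ t₁ → return (node i t₀ t₁))
eval f (treerec l s t) ρ = tick (eval f t ρ >>= treeRec
                                 (λ b → eval f l (b ∷ ρ))
                                 (λ i t₀ t₁ r₀ r₁ →
                                    eval f s (i ∷ t₀ ∷ t₁ ∷ r₀ ∷ r₁ ∷ ρ)))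
eval {n} f example     ρ = draw (λ x → stop (suc n) (x , f x))

------------------------------------------------------------------------
-- Learning algorithms

-- The inputs are the list x₁, …, xₙ of variables, s, and the numerators and
-- denominators of ε and δ.
Learner : Set
Learner = `list `var ∷ `nat ∷ `nat ∷ `nat ∷ `nat ∷ `nat ∷ [] ⊢ `tree

run : ∀ {n} → Learner → (f : Point n → Bool) → (s : ℕ) (ε δ : ℚ) → Run n (DT n)
run {n} A f s ε δ =
  eval f A (allFin n ∷ s ∷ ∣ ↥ ε ∣ ∷ ↧ₙ ε ∷ ∣ ↥ δ ∣ ∷ ↧ₙ δ ∷ [])

Good : ∀ {n} → (f : Point n → Bool) → (s : ℕ) (ε : ℚ) → Pred (DT n) _
Good f s ε h = size h ℕ.≤ s × error (compute h) f ℚ.≤ ε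

good? : ∀ {n} (f : Point n → Bool) (s : ℕ) (ε : ℚ) → Decidable (Good f s ε)
good? f s ε h = (size h ℕ.≤? s) ×-dec (error (compute h) f ℚ.≤? ε)

------------------------------------------------------------------------
-- Quantities occurring in the bounds

fromℕ : ℕ → ℚ
fromℕ k = + k / 1

inv : (p : ℚ) → .{{Positive p}} → ℚ
inv p = (1/ p) {{ℚ.pos⇒nonZero p}}

-- Logarithms in bounds are rounded up, and log n is read as 1 for n ≤ 1; for
-- n ≥ 2 and δ ≤ ½ this changes them by a factor of at most 2.
lg : ℕ → ℕ
lg n = 1 ⊔ ⌈log₂ n ⌉

-- ⌈log₂ (1/δ)⌉, which agrees with ⌈log₂ ⌈1/δ⌉⌉
lg1/ : (δ : ℚ) → .{{Positive δ}} → ℕ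
lg1/ δ = ⌈log₂ ∣ ceiling (inv δ) ∣ ⌉

module Submission where

-- A sample of size O(s log n log (1/δ) / ε) is fitted by a recursive search: with depth d left, a
-- pure sample gives a leaf, and otherwise every variable which splits the sample into two nonempty
-- parts is tried at the root, keeping a tree of smallest total size.  At depth d ≈ log (2s/ε) the
-- search stops with an arbitrary leaf of size 1.  Hence the result is never larger than any tree
-- fitting the sample, in particular it has size at most s, and the time is n^O(d).
--
-- Since only splitting variables are used, no variable is repeated along a path, so a point reaches
-- depth d with probability at most s / 2^d ≤ ε/2.  A result with error above ε is therefore wrong
-- with probability at least ε/2 on points which do not reach depth d, while it makes no such mistake
-- on the sample; a union bound over the n^O(s) trees of size at most s excludes this.

open import Defs
open import Data.Bool using (Bool; true; false; if_then_else_; not; T)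
import Data.Bool.Properties as Bool
open import Data.Empty using (⊥; ⊥-elim)
open import Data.Fin using (Fin)
import Data.Fin as Fin
open import Data.Integer using (+_; +[1+_]; -[1+_]; ∣_∣)
import Data.Integer as ℤ
import Data.Integer.DivMod as ℤ
import Data.Integer.Properties as ℤ
import Data.Integer.Tactic.RingSolver as ℤ-Solver
open import Data.List using (List; []; _∷_; length; allFin; filterᵇ; map)
import Data.List as List
import Data.List.Properties as List
open import Data.List.Membership.Propositional using (_∈_)
import Data.List.Membership.Propositional.Properties as ∈
open import Data.List.Relation.Unary.All using ([]; _∷_; lookup)
open import Data.List.Relation.Unary.Any using (here; there)
import Data.List.Relation.Unary.Any as Any
open import Data.Nat using (ℕ; zero; suc; z≤n; s≤s)
import Data.Nat as ℕ
import Data.Nat.Induction as ℕ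
open import Data.Nat.Logarithm using (⌈log₂_⌉; ⌈log₂⌈n/2⌉⌉≡⌈log₂n⌉∸1; ⌈log₂⌉-mono-≤)
import Data.Nat.Properties as ℕ
open import Data.Nat.Tactic.RingSolver using (solve-∀)
open import Data.Product using (_×_; _,_; proj₁; proj₂; Σ-syntax; ∃-syntax)
open import Data.Rational using (ℚ; mkℚ; 0ℚ; 1ℚ; ½; _+_; _*_; _-_; -_; _≤_; _<_; ↥_; ↧ₙ_; ceiling; Positive)
import Data.Rational as ℚ
import Data.Rational.Properties as ℚ
open import Data.Rational.Unnormalised using (mkℚᵘ; *≡*; *≤*)
import Data.Rational.Unnormalised.Properties as ℚᵘ
open import Data.Sum using (_⊎_; inj₁; inj₂)
open import Data.Unit using (⊤; tt)
open import Data.Vec using ([]; _∷_)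
import Data.Vec as Vec
import Data.Vec.Properties as Vec
open import Function using (_∘_; case_of_)
open import Relation.Binary.PropositionalEquality
open import Relation.Nullary using (Dec; yes; no; does; ¬_; ¬?)
open import Relation.Nullary.Decidable using (dec⇒maybe)
open import Relation.Unary using (Decidable)
import Tactic.RingSolver as Ring
open import Tactic.RingSolver.Core.AlmostCommutativeRing using (AlmostCommutativeRing; fromCommutativeRing)

-- Cost-aware reasoning about programs

-- The cut at depth d makes the search affordable, but the returned tree then need not fit the
-- sample, so the usual argument about consistent hypotheses does not apply to it. Consistency is
-- replaced by `wrong d`, which ignores cut paths and refers to one tree and one labelled point
-- only. For a fixed tree it can be tested against independent points, which is what a union bound
-- needs. Cutting does not endanger properness, because a cut leaf counts as 1 and no subtree is
-- smaller. Restricting the search to splitting variables loses nothing against the target: if the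
-- root of a fitting tree does not split the sample, one of its children already fits the whole
-- sample. The time n^d takes the required form by exchanging base and exponent: with n at most 2^g,
-- n^d is at most (2^d)^g, and 2^d is O(s/ε). The parameters are rounded to powers of two, since a
-- language with addition only can find these by repeated doubling. Each rounding costs at most a
-- factor 2. `Pr` is defined by recursion on the draws and not by a product measure, so the union
-- bound is an induction along the run.

data Yields {n} {A : Set} (c : ℕ) (P : A → Set) : Run n A → Set where
  -- The index `stop` also records that the run draws no point.
  yields : ∀ {d v} → d ℕ.≤ c → P v → Yields c P (stop d v)

module _ {n : ℕ} where

  weakenʸ : ∀ {A : Set} {P Q : A → Set} {c c′} {r : Run n A} →
            c ℕ.≤ c′ → (∀ {v} → P v → Q v) → Yields c P r → Yields c′ Q r
  weakenʸ c≤c′ P⊆Q (yields d≤c p) = yields (ℕ.≤-trans d≤c c≤c′) (P⊆Q p)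

  delayʸ : ∀ {A : Set} {P : A → Set} {c} {r : Run n A} k →
           Yields c P r → Yields (k ℕ.+ c) P (delay k r)
  delayʸ k (yields d≤c p) = yields (ℕ.+-monoʳ-≤ k d≤c) p

  bindʸ : ∀ {A B : Set} {P : A → Set} {Q : B → Set} {c c′} {r : Run n A}
            {g : A → Run n B} →
          Yields c P r → (∀ v → P v → Yields c′ Q (g v)) →
          Yields (c ℕ.+ c′) Q (r >>= g)
  bindʸ (yields {d} {v} d≤c p) h =
    weakenʸ (ℕ.+-monoˡ-≤ _ d≤c) (λ q → q) (delayʸ d (h v p))

module _ {n : ℕ} (f : Point n → Bool) where

  -- A record, so that Agda unifies terms instead of their evaluations.
  record Evals {Γ a} (ρ : Env n Γ) (t : Γ ⊢ a) (c : ℕ) (P : Val n a → Set) : Set where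
    constructor evals
    field run-yields : Yields c P (eval f t ρ)
  open Evals public

module _ {n : ℕ} {f : Point n → Bool} where

  weaken : ∀ {Γ a} {ρ : Env n Γ} {t : Γ ⊢ a} {c c′ P} →
           Evals f ρ t c P → c ℕ.≤ c′ → Evals f ρ t c′ P
  weaken (evals y) c≤c′ = evals (weakenʸ c≤c′ (λ p → p) y)

  map-evals : ∀ {Γ a} {ρ : Env n Γ} {t : Γ ⊢ a} {c} {P Q : Val n a → Set} →
              (∀ {v} → P v → Q v) → Evals f ρ t c P → Evals f ρ t c Q
  map-evals h (evals y) = evals (weakenʸ ℕ.≤-refl h y)

  computes : ∀ {Γ a} {ρ : Env n Γ} {t : Γ ⊢ a} {c v} →
             eval f t ρ ≡ stop c v → Evals f ρ t c (_≡ v)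
  computes eq = evals (subst (Yields _ _) (sym eq) (yields ℕ.≤-refl refl))

  recast : ∀ {Γ a} {ρ : Env n Γ} {t : Γ ⊢ a} {c v w} →
           Evals f ρ t c (_≡ v) → v ≡ w → Evals f ρ t c (_≡ w)
  recast e refl = e

  lam-evals : ∀ {Γ a b} {ρ : Env n Γ} {t : a ∷ Γ ⊢ b} {P : Val n a → Set}
                {Q : Val n a → Val n b → Set} {c : Val n a → ℕ} →
              (∀ v → P v → Evals f (v ∷ ρ) t (c v) (Q v)) →
              Evals f ρ (lam t) 1 (λ g → ∀ v → P v → Yields (c v) (Q v) (g v))
  lam-evals h = evals (yields ℕ.≤-refl (λ v p → run-yields (h v p)))

  app-evals : ∀ {Γ a b} {ρ : Env n Γ} {t : Γ ⊢ a `⇒ b} {u : Γ ⊢ a} {c₁ c₂ c₃}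
                {P : Val n a → Set} {Q : Val n b → Set} →
              Evals f ρ t c₁ (λ g → ∀ v → P v → Yields c₃ Q (g v)) →
              Evals f ρ u c₂ P → Evals f ρ (t · u) (1 ℕ.+ (c₁ ℕ.+ (c₂ ℕ.+ c₃))) Q
  app-evals (evals y) (evals z) =
    evals (delayʸ 1 (bindʸ y (λ g h → bindʸ z h)))

  let-evals : ∀ {Γ a b} {ρ : Env n Γ} {t : a ∷ Γ ⊢ b} {u : Γ ⊢ a} {c₁ c₂}
                {P : Val n a → Set} {Q : Val n b → Set} →
              Evals f ρ u c₁ P → (∀ v → P v → Evals f (v ∷ ρ) t c₂ Q) →
              Evals f ρ (lam t · u) (2 ℕ.+ (c₁ ℕ.+ c₂)) Q
  let-evals (evals y) h =
    evals (delayʸ 1 (delayʸ 1 (bindʸ y (λ v p → run-yields (h v p)))))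

  app₂-evals : ∀ {Γ a b d} {ρ : Env n Γ} {t : b ∷ a ∷ Γ ⊢ d} {u : Γ ⊢ a}
                 {v : Γ ⊢ b} {c₁ c₂ c₃} {P : Val n a → Set} {Q : Val n b → Set}
                 {R : Val n d → Set} →
               Evals f ρ u c₁ P → Evals f ρ v c₂ Q →
               (∀ x y → P x → Q y → Evals f (y ∷ x ∷ ρ) t c₃ R) →
               Evals f ρ (lam (lam t) · u · v)
                     (1 ℕ.+ (1 ℕ.+ (1 ℕ.+ (c₁ ℕ.+ 1)) ℕ.+ (c₂ ℕ.+ c₃))) R
  app₂-evals {P = P} {Q} {R} eu ev h =
    app-evals
      (app-evals {P = P} {Q = λ g → ∀ y → Q y → Yields _ R (g y)}
        (lam-evals {Q = λ _ g → ∀ y → Q y → Yields _ R (g y)} {c = λ _ → 1}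
          (λ x p → lam-evals {c = λ _ → _} (λ y q → h x y p q)))
        eu)
      ev

  force-evals : ∀ {Γ a} {ρ : Env n Γ} {x : (`unit `⇒ a) ∈ Γ} {c P} →
                Yields c P (lookup ρ x tt) → Evals f ρ (var x · unit) (3 ℕ.+ c) P
  force-evals y = evals (delayʸ 1 (delayʸ 1 (delayʸ 1 y)))

  ifte-evals : ∀ {Γ a} {ρ : Env n Γ} {t : Γ ⊢ `bool} {u v : Γ ⊢ a} {b c₁ c₂ c₃ x y} →
               Evals f ρ t c₁ (_≡ b) → Evals f ρ u c₂ (_≡ x) → Evals f ρ v c₃ (_≡ y) →
               Evals f ρ (ifte t u v) (1 ℕ.+ (c₁ ℕ.+ (if b then c₂ else c₃)))
                     (_≡ (if b then x else y))
  ifte-evals {b = true}  (evals y) (evals z) _ =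
    evals (delayʸ 1 (bindʸ y (λ { _ refl → z })))
  ifte-evals {b = false} (evals y) _ (evals z) =
    evals (delayʸ 1 (bindʸ y (λ { _ refl → z })))

  ifte-evals-≤ : ∀ {Γ a} {ρ : Env n Γ} {t : Γ ⊢ `bool} {u v : Γ ⊢ a}
                   {b c₁ c₂ c₃ c x y} → c₂ ℕ.≤ c → c₃ ℕ.≤ c →
                 Evals f ρ t c₁ (_≡ b) → Evals f ρ u c₂ (_≡ x) → Evals f ρ v c₃ (_≡ y) →
                 Evals f ρ (ifte t u v) (1 ℕ.+ (c₁ ℕ.+ c)) (_≡ (if b then x else y))
  ifte-evals-≤ {b = b} {c₁} {c₂} {c₃} {c} c₂≤c c₃≤c e₁ e₂ e₃ =
    weaken (ifte-evals e₁ e₂ e₃) (s≤s (ℕ.+-monoʳ-≤ c₁ (if-≤ b)))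
    where
    if-≤ : ∀ b → (if b then c₂ else c₃) ℕ.≤ c
    if-≤ true  = c₂≤c
    if-≤ false = c₃≤c

  add-evals : ∀ {Γ} {ρ : Env n Γ} {t u : Γ ⊢ `nat} {c₁ c₂ k l} →
              Evals f ρ t c₁ (_≡ k) → Evals f ρ u c₂ (_≡ l) →
              Evals f ρ (add t u) (1 ℕ.+ (c₁ ℕ.+ (c₂ ℕ.+ 0))) (_≡ k ℕ.+ l)
  add-evals (evals y) (evals z) = evals (delayʸ 1 (bindʸ y (λ { _ refl →
    bindʸ z (λ { _ refl → yields ℕ.≤-refl refl }) })))

  -- The step receives the recursive call as a thunk about which only `Yields (cost m) (P m)` is
  -- known. Each forcing is charged within `d m`, so one rule covers steps that force the thunk
  -- never, once or several times.
  natrec-evals : ∀ {Γ a} {ρ : Env n Γ} {z : Γ ⊢ a} {s : `nat ∷ (`unit `⇒ a) ∷ Γ ⊢ a}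
                   {t : Γ ⊢ `nat} {c c₀ k} {d : ℕ → ℕ} (cost : ℕ → ℕ) (P : ℕ → Val n a → Set) →
                 Evals f ρ t c (_≡ k) →
                 Evals f ρ z c₀ (P 0) → suc c₀ ℕ.≤ cost 0 →
                 (∀ m r → Yields (cost m) (P m) (r tt) →
                    Evals f (m ∷ r ∷ ρ) s (d m) (P (suc m))) →
                 (∀ m → suc (d m) ℕ.≤ cost (suc m)) →
                 Evals f ρ (natrec z s t) (1 ℕ.+ (c ℕ.+ cost k)) (P k)
  natrec-evals {ρ = ρ} {z} {s} {k = k} cost P (evals y) (evals w) c₀≤ h d≤ =
    evals (delayʸ 1 (bindʸ y (λ { _ refl → go k })))
    where
    go : ∀ k → Yields (cost k) (P k)
                      (natRec (eval f z ρ) (λ m r → eval f s (m ∷ r ∷ ρ)) k)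
    go zero    = weakenʸ {P = P 0} c₀≤ (λ p → p) (delayʸ 1 w)
    go (suc m) = weakenʸ {P = P (suc m)} (d≤ m) (λ p → p) (delayʸ 1 (run-yields (h m (λ _ → natRec (eval f z ρ) (λ m r → eval f s (m ∷ r ∷ ρ)) m) (go m))))

  listrec-evals : ∀ {Γ a b} {ρ : Env n Γ} {z : Γ ⊢ b}
                    {s : a ∷ `list a ∷ (`unit `⇒ b) ∷ Γ ⊢ b}
                    {t : Γ ⊢ `list a} {c c₀ xs} {d : Val n a → List (Val n a) → ℕ}
                    (cost : List (Val n a) → ℕ)
                    (P : List (Val n a) → Val n b → Set) →
                  Evals f ρ t c (_≡ xs) →
                  Evals f ρ z c₀ (P []) → suc c₀ ℕ.≤ cost [] →
                  (∀ x xs r → Yields (cost xs) (P xs) (r tt) →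
                     Evals f (x ∷ xs ∷ r ∷ ρ) s (d x xs) (P (x ∷ xs))) →
                  (∀ x xs → suc (d x xs) ℕ.≤ cost (x ∷ xs)) →
                  Evals f ρ (listrec z s t) (1 ℕ.+ (c ℕ.+ cost xs)) (P xs)
  listrec-evals {ρ = ρ} {z} {s} {xs = xs} cost P (evals y) (evals w) c₀≤ h d≤ =
    evals (delayʸ 1 (bindʸ y (λ { _ refl → go xs })))
    where
    go : ∀ xs → Yields (cost xs) (P xs)
                       (listRec (eval f z ρ) (λ x xs r → eval f s (x ∷ xs ∷ r ∷ ρ)) xs)
    go []       = weakenʸ {P = P []} c₀≤ (λ p → p) (delayʸ 1 w)
    go (x ∷ xs) = weakenʸ {P = P (x ∷ xs)} (d≤ x xs) (λ p → p) (delayʸ 1 (run-yields (h x xs (λ _ → listRec (eval f z ρ) (λ x xs r → eval f s (x ∷ xs ∷ r ∷ ρ)) xs)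
                                         (go xs))))

-- Doubling, filtering and arithmetic as programs

v₀ : ∀ {Γ : Ctx} {a} → a ∈ a ∷ Γ
v₀ = here refl

v₁ : ∀ {Γ : Ctx} {a b} → a ∈ b ∷ a ∷ Γ
v₁ = there v₀

v₂ : ∀ {Γ : Ctx} {a b c} → a ∈ b ∷ c ∷ a ∷ Γ
v₂ = there v₁

v₃ : ∀ {Γ : Ctx} {a b c d} → a ∈ b ∷ c ∷ d ∷ a ∷ Γ
v₃ = there v₂

v₄ : ∀ {Γ : Ctx} {a b c d e} → a ∈ b ∷ c ∷ d ∷ e ∷ a ∷ Γ
v₄ = there v₃

-- For 1 ≤ a and fuel t this is the logarithm of t / a to base 2, rounded up, and 0 if t ≤ a. The
-- fuel only serves the recursion: t doublings always suffice, because t < 2^t.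
doublings : (fuel a t : ℕ) → ℕ
doublings zero    a t = 0
doublings (suc k) a t = if t ℕ.≤ᵇ a then 0 else suc (doublings k (a ℕ.+ a) t)

doublings-bodyᵗ : ∀ {Γ} → `nat ∷ `nat ∷ (`unit `⇒ `nat `⇒ `nat) ∷ `nat ∷ `nat ∷ Γ ⊢ `nat
doublings-bodyᵗ =
  ifte (leq (var v₄) (var v₀))
       (lit 0)
       (add (lit 1) ((var v₂ · unit) · add (var v₀) (var v₀)))

doublingsᵗ : ∀ {Γ} → Γ ⊢ `nat `⇒ `nat `⇒ `nat
doublingsᵗ =
  lam (lam (natrec (lam (lit 0)) (lam doublings-bodyᵗ) (var v₁) · var v₀))

timesᵗ : ∀ {Γ} → Γ ⊢ `nat `⇒ `nat `⇒ `nat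
timesᵗ = lam (lam (natrec (lit 0) (add (var v₂) (var v₁ · unit)) (var v₁)))

doubleᵗ : ∀ {Γ} → Γ ⊢ `nat → Γ ⊢ `nat → Γ ⊢ `nat
doubleᵗ x k = natrec x (lam (add (var v₀) (var v₀)) · (var v₁ · unit)) k

lengthᵗ : ∀ {Γ a} → Γ ⊢ `list a → Γ ⊢ `nat
lengthᵗ = listrec (lit 0) (add (lit 1) (var v₂ · unit))

nullᵗ : ∀ {Γ a} → Γ ⊢ `list a → Γ ⊢ `bool
nullᵗ = listrec (bool true) (bool false)

-- The predicate finds the element of the list at v₁.
filterᵗ : ∀ {Γ a} →
          `list a ∷ a ∷ `list a ∷ (`unit `⇒ `list a) ∷ Γ ⊢ `bool →
          Γ ⊢ `list a → Γ ⊢ `list a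
filterᵗ p = listrec nil (lam (ifte p (cons (var v₁) (var v₀)) (var v₀)) · (var v₂ · unit))

null : {A : Set} → List A → Bool
null []      = true
null (_ ∷ _) = false

module _ {n : ℕ} {f : Point n → Bool} where

  -- The cost distinguishes the branches so that the total is proportional to the doublings
  -- performed and not to the fuel. The fuel can be the denominator of ε or δ, which is not bounded
  -- in terms of 1/ε or 1/δ.
  doublings-body-evals :
    ∀ {Γ} (ρ : Env n Γ) (a m start t : ℕ) {r l c} →
    Yields 2 (λ g → ∀ v → v ≡ a ℕ.+ a → Yields c (_≡ l) (g v)) (r tt) →
    Evals f (a ∷ m ∷ r ∷ start ∷ t ∷ ρ) doublings-bodyᵗ
          (4 ℕ.+ (if t ℕ.≤ᵇ a then 1 else 11 ℕ.+ c))
          (_≡ (if t ℕ.≤ᵇ a then 0 else suc l))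
  doublings-body-evals ρ a m start t {l = l} {c} y =
    ifte-evals (computes refl) (computes refl)
      (weaken
        (add-evals (computes refl)
          (app-evals {P = _≡ a ℕ.+ a} (force-evals y) (computes refl)))
        (ℕ.≤-reflexive (lem c)))
    where
    lem : ∀ c → 1 ℕ.+ (1 ℕ.+ (1 ℕ.+ (5 ℕ.+ (3 ℕ.+ c)) ℕ.+ 0)) ≡ 11 ℕ.+ c
    lem = solve-∀

  doublings-evals : ∀ {Γ} {ρ : Env n Γ} {u v c₁ c₂ start t} →
    Evals f ρ u c₁ (_≡ t) → Evals f ρ v c₂ (_≡ start) →
    Evals f ρ (doublingsᵗ · u · v) (25 ℕ.+ (c₁ ℕ.+ c₂ ℕ.+ 15 ℕ.* doublings t start t))
          (_≡ doublings t start t)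
  doublings-evals {ρ = ρ} {c₁ = c₁} {c₂} {start} {t} eu ev = weaken
    (app₂-evals eu ev λ { _ _ refl refl →
      app-evals {P = _≡ start} {Q = _≡ doublings t start t}
        -- At function type the recursor returns a closure in constant time. The work is paid only
        -- when the closure is applied, and it stops at the first successful test.
        (map-evals (λ h → h start) (natrec-evals {d = λ _ → 1} (λ _ → 2)
          (λ k g → ∀ a v → v ≡ a →
             Yields (15 ℕ.* suc (doublings k a t)) (_≡ doublings k a t) (g v))
          (computes refl)
          (evals (yields ℕ.≤-refl (λ a v _ → yields (s≤s z≤n) refl))) ℕ.≤-refl
          (λ k r h → evals (yields ℕ.≤-refl (λ { a _ refl →
            weakenʸ (cost k a) (λ p → p)
              (run-yields (doublings-body-evals ρ a k start t
                 (weakenʸ ℕ.≤-refl (λ g v → g _ v) h))) })))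
          (λ _ → ℕ.≤-refl)))
        (computes refl) })
    (ℕ.≤-reflexive (lem c₁ c₂ (doublings t start t)))
    where
    lem : ∀ c₁ c₂ x → 1 ℕ.+ (1 ℕ.+ (1 ℕ.+ (c₁ ℕ.+ 1)) ℕ.+ (c₂ ℕ.+
                        (1 ℕ.+ (4 ℕ.+ (1 ℕ.+ 15 ℕ.* suc x)))))
                    ≡ 25 ℕ.+ (c₁ ℕ.+ c₂ ℕ.+ 15 ℕ.* x)
    lem = solve-∀
    cost : ∀ k a → 4 ℕ.+ (if t ℕ.≤ᵇ a then 1 else 11 ℕ.+ 15 ℕ.* suc (doublings k (a ℕ.+ a) t))
             ℕ.≤ 15 ℕ.* suc (doublings (suc k) a t)
    cost k a with t ℕ.≤ᵇ a
    ... | true  = ℕ.≤ᵇ⇒≤ 5 15 tt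
    ... | false = ℕ.≤-reflexive (sym (ℕ.*-suc 15 (suc (doublings k (a ℕ.+ a) t))))

  times-evals : ∀ {Γ} {ρ : Env n Γ} {u v c₁ c₂ x y} →
    Evals f ρ u c₁ (_≡ x) → Evals f ρ v c₂ (_≡ y) →
    Evals f ρ (timesᵗ · u · v) (8 ℕ.+ (c₁ ℕ.+ c₂ ℕ.+ 6 ℕ.* x)) (_≡ x ℕ.* y)
  times-evals {c₁ = c₁} {c₂} {x} {y} eu ev = weaken
    (app₂-evals eu ev λ { _ _ refl refl →
      natrec-evals (λ k → 2 ℕ.+ 6 ℕ.* k) (λ k v → v ≡ k ℕ.* y)
        (computes refl) (computes refl) ℕ.≤-refl
        (λ k r h → add-evals (computes refl) (force-evals h))
        (λ k → ℕ.≤-reflexive (step k)) })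
    (ℕ.≤-reflexive (lem c₁ c₂ x))
    where
    lem : ∀ c₁ c₂ x → 1 ℕ.+ (1 ℕ.+ (1 ℕ.+ (c₁ ℕ.+ 1)) ℕ.+ (c₂ ℕ.+ (1 ℕ.+ (1 ℕ.+ (2 ℕ.+ 6 ℕ.* x)))))
                    ≡ 8 ℕ.+ (c₁ ℕ.+ c₂ ℕ.+ 6 ℕ.* x)
    lem = solve-∀
    step : ∀ k → 1 ℕ.+ (1 ℕ.+ (1 ℕ.+ (3 ℕ.+ (2 ℕ.+ 6 ℕ.* k) ℕ.+ 0))) ≡ 2 ℕ.+ 6 ℕ.* suc k
    step = solve-∀

  double-evals : ∀ {Γ} {ρ : Env n Γ} {u v c₁ c₂ x k} →
    Evals f ρ u c₁ (_≡ x) → Evals f ρ v c₂ (_≡ k) →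
    Evals f ρ (doubleᵗ u v) (2 ℕ.+ (c₁ ℕ.+ c₂ ℕ.+ 9 ℕ.* k)) (_≡ 2 ℕ.^ k ℕ.* x)
  double-evals {c₁ = c₁} {c₂} {x} {k} eu ev = weaken
    (natrec-evals (λ k → 1 ℕ.+ c₁ ℕ.+ 9 ℕ.* k) (λ k v → v ≡ 2 ℕ.^ k ℕ.* x)
      ev (recast eu (sym (ℕ.+-identityʳ x))) (ℕ.≤-reflexive (sym (ℕ.+-identityʳ (suc c₁))))
      (λ k r h → let-evals (force-evals h)
        (λ { _ refl → recast (computes refl) (twice (2 ℕ.^ k) x) }))
      (λ k → ℕ.≤-reflexive (step c₁ k)))
    (ℕ.≤-reflexive (lem c₁ c₂ k))
    where
    lem : ∀ c₁ c₂ k → 1 ℕ.+ (c₂ ℕ.+ (1 ℕ.+ c₁ ℕ.+ 9 ℕ.* k)) ≡ 2 ℕ.+ (c₁ ℕ.+ c₂ ℕ.+ 9 ℕ.* k)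
    lem = solve-∀
    step : ∀ c k → 1 ℕ.+ (2 ℕ.+ (3 ℕ.+ (1 ℕ.+ c ℕ.+ 9 ℕ.* k) ℕ.+ 3)) ≡ 1 ℕ.+ c ℕ.+ 9 ℕ.* suc k
    step = solve-∀
    twice : ∀ p x → p ℕ.* x ℕ.+ p ℕ.* x ≡ 2 ℕ.* p ℕ.* x
    twice = solve-∀

  length-evals : ∀ {Γ a} {ρ : Env n Γ} {u : Γ ⊢ `list a} {c xs} →
    Evals f ρ u c (_≡ xs) →
    Evals f ρ (lengthᵗ u) (3 ℕ.+ (c ℕ.+ 6 ℕ.* length xs)) (_≡ length xs)
  length-evals {c = c} {xs} eu = weaken
    (listrec-evals (λ xs → 2 ℕ.+ 6 ℕ.* length xs) (λ xs v → v ≡ length xs)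
      eu (computes refl) ℕ.≤-refl
      (λ x xs r h → add-evals (computes refl) (force-evals h))
      (λ x xs → ℕ.≤-reflexive (step (length xs))))
    (ℕ.≤-reflexive (lem c (length xs)))
    where
    lem : ∀ c x → 1 ℕ.+ (c ℕ.+ (2 ℕ.+ 6 ℕ.* x)) ≡ 3 ℕ.+ (c ℕ.+ 6 ℕ.* x)
    lem = solve-∀
    step : ∀ k → 1 ℕ.+ (1 ℕ.+ (1 ℕ.+ (3 ℕ.+ (2 ℕ.+ 6 ℕ.* k) ℕ.+ 0))) ≡ 2 ℕ.+ 6 ℕ.* suc k
    step = solve-∀

  null-evals : ∀ {Γ a} {ρ : Env n Γ} {u : Γ ⊢ `list a} {c xs} →
    Evals f ρ u c (_≡ xs) → Evals f ρ (nullᵗ u) (1 ℕ.+ (c ℕ.+ 2)) (_≡ null xs)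
  null-evals eu =
    listrec-evals (λ _ → 2) (λ xs v → v ≡ null xs) eu (computes refl) ℕ.≤-refl
      (λ x xs r h → computes refl) (λ x xs → ℕ.≤-refl)

  filter-evals : ∀ {Γ a} {ρ : Env n Γ} {p} {u : Γ ⊢ `list a} {c k xs}
                   (π : Val n a → Bool) →
    (∀ {x xs ys r} → Evals f (ys ∷ x ∷ xs ∷ r ∷ ρ) p k (_≡ π x)) →
    Evals f ρ u c (_≡ xs) →
    Evals f ρ (filterᵗ p u) (3 ℕ.+ (c ℕ.+ (10 ℕ.+ k) ℕ.* length xs)) (_≡ filterᵇ π xs)
  filter-evals {a = a} {c = c} {k} {xs} π ep eu = weaken
    (listrec-evals (λ xs → 2 ℕ.+ (10 ℕ.+ k) ℕ.* length xs) (λ xs v → v ≡ filterᵇ π xs)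
      eu (computes refl) (s≤s (s≤s z≤n))
      (λ x xs r h → let-evals (force-evals h)
        (λ { _ refl → recast
            (ifte-evals-≤ ℕ.≤-refl (s≤s z≤n) ep (computes refl) (computes refl))
            (choose {x} (π x) refl) }))
      (λ x xs → ℕ.≤-reflexive (step k (length xs))))
    (ℕ.≤-reflexive (lem c k (length xs)))
    where
    lem : ∀ c k x → 1 ℕ.+ (c ℕ.+ (2 ℕ.+ (10 ℕ.+ k) ℕ.* x)) ≡ 3 ℕ.+ (c ℕ.+ (10 ℕ.+ k) ℕ.* x)
    lem = solve-∀
    step : ∀ k x → 1 ℕ.+ (2 ℕ.+ (3 ℕ.+ (2 ℕ.+ (10 ℕ.+ k) ℕ.* x) ℕ.+ (1 ℕ.+ (k ℕ.+ 3))))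
                 ≡ 2 ℕ.+ (10 ℕ.+ k) ℕ.* suc x
    step = solve-∀
    choose : ∀ {x : Val n a} {ys} b → π x ≡ b →
             (if b then x ∷ filterᵇ π ys else filterᵇ π ys) ≡ filterᵇ π (x ∷ ys)
    choose {x} b eq with π x | eq
    ... | true  | refl = refl
    ... | false | refl = refl

-- The learner

v₅ : ∀ {Γ : Ctx} {a b c d e f} → a ∈ b ∷ c ∷ d ∷ e ∷ f ∷ a ∷ Γ
v₅ = there v₄

v₆ : ∀ {Γ : Ctx} {a b c d e f g} → a ∈ b ∷ c ∷ d ∷ e ∷ f ∷ g ∷ a ∷ Γ
v₆ = there v₅

v₉ : ∀ {Γ : Ctx} {a b c d e f g h i j} → a ∈ b ∷ c ∷ d ∷ e ∷ f ∷ g ∷ h ∷ i ∷ j ∷ a ∷ Γ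
v₉ = there (there (there v₆))

`example : Ty
`example = `point `× `bool

notᵗ : ∀ {Γ} → Γ ⊢ `bool → Γ ⊢ `bool
notᵗ t = ifte t (bool false) (bool true)

betterᵗ : ∀ {Γ} → Γ ⊢ `var → (t₀ t₁ r : Γ ⊢ `nat `× `tree) → Γ ⊢ `nat `× `tree
betterᵗ i t₀ t₁ r =
  ifte (leq (add (fst t₀) (fst t₁)) (fst r))
       (pair (add (fst t₀) (fst t₁)) (node i (snd t₀) (snd t₁)))
       r

-- In the context: the variable i, the other variables, their recursive call,
-- the sample and the learner of smaller depth.
branchᵗ : ∀ {Γ} → `var ∷ `list `var ∷ (`unit `⇒ `nat `× `tree) ∷ `list `example ∷ `nat ∷
                  (`unit `⇒ `list `example `⇒ `nat `× `tree) ∷ Γ ⊢ `nat `× `tree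
branchᵗ =
  lam (lam (lam
    (ifte (nullᵗ (var v₁)) (var v₂)
    (ifte (nullᵗ (var v₀)) (var v₂)
    (lam (lam (betterᵗ (var v₅) (var v₁) (var v₀) (var v₄))
      · ((var v₉ · unit) · var v₁))
      · ((var (there (there v₆)) · unit) · var v₁))))
    · filterᵗ (bit (fst (var v₁)) (var v₆)) (var v₅))
    · filterᵗ (notᵗ (bit (fst (var v₁)) (var v₅))) (var v₄))
    · (var v₂ · unit)

Inputs : Ctx
Inputs = `list `var ∷ `nat ∷ `nat ∷ `nat ∷ `nat ∷ `nat ∷ []

learn-bodyᵗ : `list `example ∷ `nat ∷ (`unit `⇒ `list `example `⇒ `nat `× `tree) ∷ Inputs
              ⊢ `nat `× `tree
learn-bodyᵗ =
  ifte (nullᵗ (filterᵗ (snd (var v₁)) (var v₀))) (pair (lit 1) (leaf (bool false)))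
  (ifte (nullᵗ (filterᵗ (notᵗ (snd (var v₁))) (var v₀))) (pair (lit 1) (leaf (bool true)))
  (listrec (pair (add (lit 1) (var v₄)) (leaf (bool false))) branchᵗ (var v₃)))

learnᵗ : Inputs ⊢ `nat → Inputs ⊢ `list `example `⇒ `nat `× `tree
learnᵗ = natrec (lam (pair (lit 1) (leaf (bool false)))) (lam learn-bodyᵗ)

-- The functions that the programs compute, and their cost

Example : ℕ → Set
Example n = Point n × Bool

module _ {n : ℕ} where

  one? zero? : Fin n → Example n → Bool
  one?  i (x , _) = Vec.lookup x i
  zero? i e       = if one? i e then false else true

  negative? : Example n → Bool
  negative? (_ , b) = if b then false else true

  zeros ones : Fin n → List (Example n) → List (Example n)
  zeros i = filterᵇ (zero? i)
  ones  i = filterᵇ (one? i)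

  better : Fin n → (t₀ t₁ r : ℕ × DT n) → ℕ × DT n
  better i (k₀ , t₀) (k₁ , t₁) (k , t) =
    if k₀ ℕ.+ k₁ ℕ.≤ᵇ k then (k₀ ℕ.+ k₁ , node i t₀ t₁) else (k , t)

  best : (List (Example n) → ℕ × DT n) → ℕ → List (Example n) → List (Fin n) → ℕ × DT n
  -- The claimed size s + 1 marks a failed search: it loses against every tree of admissible size,
  -- and nothing is promised about a tree whose claimed size exceeds s.
  best L s S []       = suc s , leaf false
  best L s S (i ∷ is) =
    if null (zeros i S) then best L s S is else
    if null (ones i S)  then best L s S is else
    better i (L (zeros i S)) (L (ones i S)) (best L s S is)

  learn : List (Fin n) → (s depth : ℕ) → List (Example n) → ℕ × DT n
  learn is s zero    S = 1 , leaf false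
  learn is s (suc d) S =
    if null (filterᵇ proj₂ S) then (1 , leaf false) else
    if null (filterᵇ negative? S) then (1 , leaf true) else
    best (learn is s d) s S is

  -- The cost c depends on the sample only through the length bound m. Filtering preserves this
  -- bound, so the time recurrence runs over the depth alone.
  Learns : ℕ → ℕ → (List (Example n) → ℕ × DT n) → (List (Example n) → Run n (ℕ × DT n)) → Set
  Learns m c L g = ∀ S T → T ≡ S → length S ℕ.≤ m → Yields c (_≡ L S) (g T)

-- Each of the n candidate roots may cause two recursive calls. The numerals count evaluation steps:
-- two purity tests at each level, and two filters for each candidate.
learn-time : (n m depth : ℕ) → ℕ
learn-time n m zero    = 4
learn-time n m (suc d) = 25 ℕ.+ 26 ℕ.* m ℕ.+ n ℕ.* (67 ℕ.+ 30 ℕ.* m ℕ.+ 2 ℕ.* learn-time n m d)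

module _ {n : ℕ} {f : Point n → Bool} where

  branch-evals : ∀ {Γ} (ρ : Env n Γ) i is S d s {r r′ m c k} (L : List (Example n) → ℕ × DT n) →
    Yields 2 (Learns m c L) (r tt) → length S ℕ.≤ m →
    Yields k (_≡ best L s S is) (r′ tt) →
    Evals f (i ∷ is ∷ r′ ∷ S ∷ d ∷ r ∷ ρ) branchᵗ (66 ℕ.+ 30 ℕ.* m ℕ.+ 2 ℕ.* c ℕ.+ k)
          (_≡ best L s S (i ∷ is))
  branch-evals ρ i is S d s {m = m} {c} {k} L hL ≤m hbest =
    weaken
      (let-evals (force-evals hbest) λ { _ refl →
       let-evals (filter-evals (zero? i)
                   (ifte-evals-≤ ℕ.≤-refl ℕ.≤-refl (computes refl) (computes refl) (computes refl))
                   (computes refl)) λ { _ refl →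
       let-evals (filter-evals (one? i) (computes refl) (computes refl))
         λ { _ refl →
       ifte-evals-≤ (s≤s z≤n) ℕ.≤-refl (null-evals (computes refl)) (computes refl)
      (ifte-evals-≤ (s≤s z≤n) ℕ.≤-refl (null-evals (computes refl)) (computes refl)
         (let-evals (app-evals {P = _≡ zeros i S}
                      (force-evals (weakenʸ ℕ.≤-refl (λ h T eq → h _ T eq (shorter _)) hL))
                      (computes refl)) λ { _ refl →
          let-evals (app-evals {P = _≡ ones i S}
                      (force-evals (weakenʸ ℕ.≤-refl (λ h T eq → h _ T eq (shorter _)) hL))
                      (computes refl)) λ { _ refl →
          ifte-evals-≤ ℕ.≤-refl (s≤s z≤n) (computes refl) (computes refl) (computes refl)}})) }}})
      (ℕ.≤-trans (ℕ.≤-reflexive (lem (length S) c k))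
         (ℕ.+-monoˡ-≤ k (ℕ.+-monoˡ-≤ (2 ℕ.* c) (ℕ.+-monoʳ-≤ 66 (ℕ.*-monoʳ-≤ 30 ≤m)))))
    where
    lem : ∀ l c k → 2 ℕ.+ (3 ℕ.+ k ℕ.+ (2 ℕ.+ (3 ℕ.+ (1 ℕ.+ 16 ℕ.* l) ℕ.+ (2 ℕ.+ (3 ℕ.+ (1 ℕ.+ 14 ℕ.* l) ℕ.+
             (1 ℕ.+ (4 ℕ.+ (1 ℕ.+ (4 ℕ.+ (2 ℕ.+ (1 ℕ.+ (5 ℕ.+ (1 ℕ.+ c)) ℕ.+ (2 ℕ.+ (1 ℕ.+ (5 ℕ.+ (1 ℕ.+ c)) ℕ.+
             (1 ℕ.+ (8 ℕ.+ 12)))))))))))))))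
           ≡ 66 ℕ.+ 30 ℕ.* l ℕ.+ 2 ℕ.* c ℕ.+ k
    lem = solve-∀

    shorter : ∀ π → length (filterᵇ π S) ℕ.≤ m
    shorter π = ℕ.≤-trans (List.length-filter (λ e → Bool.T? (π e)) S) ≤m

  learn-body-evals : ∀ is s {ρ} S d {r m c} →
    Yields 2 (Learns m c (learn is s d)) (r tt) → length S ℕ.≤ m →
    Evals f (S ∷ d ∷ r ∷ is ∷ s ∷ ρ) learn-bodyᵗ
          (25 ℕ.+ 26 ℕ.* m ℕ.+ length is ℕ.* (67 ℕ.+ 30 ℕ.* m ℕ.+ 2 ℕ.* c))
          (_≡ learn is s (suc d) S)
  learn-body-evals is s {ρ} S d {r} {m} {c} hL ≤m =
    weaken
      (ifte-evals-≤ {c₂ = 4} (s≤s (s≤s (s≤s (s≤s z≤n)))) ℕ.≤-refl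
        (null-evals (filter-evals proj₂ (computes refl) (computes refl)))
        (computes refl)
      (ifte-evals-≤ {c₂ = 4} (s≤s (s≤s (s≤s (s≤s z≤n)))) ℕ.≤-refl
        (null-evals (filter-evals negative?
          (ifte-evals-≤ ℕ.≤-refl ℕ.≤-refl (computes refl) (computes refl) (computes refl))
          (computes refl)))
        (computes refl)
        (listrec-evals
          (λ is → 7 ℕ.+ length is ℕ.* (67 ℕ.+ 30 ℕ.* m ℕ.+ 2 ℕ.* c))
          (λ is v → v ≡ best (learn is₀ s d) s S is)
          (computes refl) (computes refl) ℕ.≤-refl
          (λ i is r′ h → branch-evals (is₀ ∷ s ∷ ρ) i is S d s (learn is₀ s d) hL ≤m h)
          (λ i is → ℕ.≤-reflexive (step (30 ℕ.* m) (2 ℕ.* c) (length is ℕ.* (67 ℕ.+ 30 ℕ.* m ℕ.+ 2 ℕ.* c)))))))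
      (ℕ.≤-trans (ℕ.≤-reflexive (lem (length S) (length is ℕ.* (67 ℕ.+ 30 ℕ.* m ℕ.+ 2 ℕ.* c))))
         (ℕ.+-monoˡ-≤ _ (ℕ.+-monoʳ-≤ 25 (ℕ.*-monoʳ-≤ 26 ≤m))))
    where
    is₀ = is
    step : ∀ a a′ b → 1 ℕ.+ (66 ℕ.+ a ℕ.+ a′ ℕ.+ (7 ℕ.+ b)) ≡ 7 ℕ.+ (67 ℕ.+ a ℕ.+ a′ ℕ.+ b)
    step = solve-∀
    lem : ∀ l k → 1 ℕ.+ (1 ℕ.+ (3 ℕ.+ (1 ℕ.+ 12 ℕ.* l) ℕ.+ 2) ℕ.+ (1 ℕ.+ (1 ℕ.+ (3 ℕ.+ (1 ℕ.+ 14 ℕ.* l) ℕ.+ 2) ℕ.+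
              (1 ℕ.+ (1 ℕ.+ (7 ℕ.+ k)))))) ≡ 25 ℕ.+ 26 ℕ.* l ℕ.+ k
    lem = solve-∀

  learn-evals : ∀ is s {ρ u c m d} →
    Evals f (is ∷ s ∷ ρ) u c (_≡ d) →
    Evals f (is ∷ s ∷ ρ) (learnᵗ u) (3 ℕ.+ c)
          (Learns m (learn-time (length is) m d) (learn is s d))
  learn-evals is s {ρ} {c = c} {m} eu = weaken
    (natrec-evals {d = λ _ → 1} (λ _ → 2)
      (λ d → Learns m (learn-time (length is) m d) (learn is s d))
      eu
      (evals (yields ℕ.≤-refl (λ S _ _ _ → yields ℕ.≤-refl refl))) ℕ.≤-refl
      (λ d r h → evals (yields ℕ.≤-refl (λ { S _ refl ≤m →
        run-yields (learn-body-evals is s {ρ} S d {r} h ≤m) })))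
      (λ _ → ℕ.≤-refl))
    (ℕ.≤-reflexive (cong suc (ℕ.+-comm c 2)))

-- Drawing the sample

-- The number of draws is the same on every path. This gives the worst-case bounds for queries and
-- time at once, and it is the structure over which the union bound is an induction.
data Draws {n} {A : Set} (c : ℕ) :
       ℕ → (List (Point n) → A → Set) → Run n A → Set₁ where
  finished : ∀ {P r} → Yields c (P []) r → Draws c 0 P r
  drawn    : ∀ {m P k} → (∀ x → Draws c m (λ xs → P (x ∷ xs)) (k x)) →
             Draws c (suc m) P (draw k)

module _ {n : ℕ} where

  delayᵈ : ∀ {A : Set} {c m P} {r : Run n A} k →
           Draws c m P r → Draws (k ℕ.+ c) m P (delay k r)
  delayᵈ k (finished y) = finished (delayʸ k y)
  delayᵈ k (drawn h)    = drawn (λ x → delayᵈ k (h x))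

  weakenᵈ : ∀ {A : Set} {c c′ m P} {r : Run n A} → c ℕ.≤ c′ → Draws c m P r → Draws c′ m P r
  weakenᵈ c≤c′ (finished y) = finished (weakenʸ c≤c′ (λ p → p) y)
  weakenᵈ c≤c′ (drawn h)    = drawn (λ x → weakenᵈ c≤c′ (h x))

  bindᵈ : ∀ {A B : Set} {c c′ m P} {Q : List (Point n) → B → Set} {r : Run n A}
            {g : A → Run n B} →
          Draws c m P r → (∀ xs v → P xs v → Yields c′ (Q xs) (g v)) →
          Draws (c ℕ.+ c′) m Q (r >>= g)
  bindᵈ (finished y) h = finished (bindʸ y (h []))
  bindᵈ (drawn k)    h = drawn (λ x → bindᵈ (k x) (λ xs → h (x ∷ xs)))

  bindʸᵈ : ∀ {A B : Set} {c c′ m P} {Q : List (Point n) → B → Set} {r : Run n A}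
             {g : A → Run n B} →
           Yields c P r → (∀ v → P v → Draws c′ m Q (g v)) →
           Draws (c ℕ.+ c′) m Q (r >>= g)
  bindʸᵈ (yields {d} {v} d≤c p) h = weakenᵈ (ℕ.+-monoˡ-≤ _ d≤c) (delayᵈ d (h v p))

  queries-drawn : ∀ {A : Set} {c m P} {r : Run n A} → Draws c m P r → ∀ ω → queries r ω ≡ m
  queries-drawn (finished (yields _ _)) ω = refl
  queries-drawn (drawn h)               ω = cong suc (queries-drawn (h (ω 0)) (ω ∘ suc))

  time-drawn : ∀ {A : Set} {c m P} {r : Run n A} → Draws c m P r → ∀ ω → time r ω ℕ.≤ c
  time-drawn (finished (yields d≤c _)) ω = d≤c
  time-drawn (drawn h)                 ω = time-drawn (h (ω 0)) (ω ∘ suc)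

sampleᵗ : Inputs ⊢ `nat → Inputs ⊢ `list `example
sampleᵗ = natrec nil (cons example (var v₁ · unit))

-- The inputs are at v₀ … v₅ : the variables, s, then numerator and denominator of ε and of δ.
-- With 2^a ≥ 1/ε, 2^e ≥ s, 2^g ≥ n and 2^L ≥ 1/δ, the depth is 1 + a + e and the sample size is
-- 2^(1+a) · 7sgL: there are at most 2^(6sg) trees, so that 6sgL halvings pay for the union bound.
tolerance-exponentᵗ : Inputs ⊢ `nat
tolerance-exponentᵗ = doublingsᵗ · var v₃ · var v₂

depthᵗ : Inputs ⊢ `nat
depthᵗ = add (add (lit 1) tolerance-exponentᵗ) (doublingsᵗ · var v₁ · lit 1)

log-nᵗ : Inputs ⊢ `nat
log-nᵗ = add (lit 1) (doublingsᵗ · lengthᵗ (var v₀) · lit 2)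

sample-sizeᵗ : Inputs ⊢ `nat
sample-sizeᵗ =
  doubleᵗ (timesᵗ · lit 7 · (timesᵗ · var v₁ · (timesᵗ · log-nᵗ · (doublingsᵗ · var v₅ · var v₄))))
          (add (lit 1) tolerance-exponentᵗ)

learner : Learner
learner = snd (learnᵗ depthᵗ · sampleᵗ sample-sizeᵗ)

label : ∀ {n} → (Point n → Bool) → List (Point n) → List (Example n)
label f = map (λ x → x , f x)

module _ {n : ℕ} {f : Point n → Bool} where

  sample-draws : ∀ {ρ t c m} → Evals f ρ t c (_≡ m) →
    Draws (1 ℕ.+ (c ℕ.+ (2 ℕ.+ m ℕ.* (n ℕ.+ 6)))) m (λ xs v → v ≡ label f xs × length xs ≡ m)
          (eval f (sampleᵗ t) ρ)
  sample-draws {ρ} {m = m} (evals y) = delayᵈ 1 (bindʸᵈ y (λ { _ refl → go m }))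
    where
    lem : ∀ n k → 1 ℕ.+ (1 ℕ.+ (1 ℕ.+ n ℕ.+ (3 ℕ.+ k ℕ.+ 0))) ≡ n ℕ.+ 6 ℕ.+ k
    lem = solve-∀
    lem′ : ∀ n k → n ℕ.+ 6 ℕ.+ (2 ℕ.+ k) ≡ 2 ℕ.+ (n ℕ.+ 6 ℕ.+ k)
    lem′ = solve-∀
    go : ∀ k → Draws (2 ℕ.+ k ℕ.* (n ℕ.+ 6)) k (λ xs v → v ≡ label f xs × length xs ≡ k)
                 (natRec (eval f nil ρ)
                         (λ m r → eval f (cons example (var v₁ · unit)) (m ∷ r ∷ ρ)) k)
    go zero    = finished (yields ℕ.≤-refl (refl , refl))
    go (suc k) = drawn λ x → weakenᵈ
      (ℕ.≤-reflexive (trans (lem n (2 ℕ.+ k ℕ.* (n ℕ.+ 6))) (lem′ n (k ℕ.* (n ℕ.+ 6)))))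
      (delayᵈ 1 (delayᵈ 1 (delayᵈ (suc n)
        (bindᵈ (delayᵈ 1 (delayᵈ 1 (delayᵈ 1 (go k)))) λ { _ _ (refl , eq) → yields ℕ.≤-refl (refl , cong suc eq) }))))

module _ {n : ℕ} (f : Point n → Bool) (s en ed dn dd : ℕ) where

  private
    a = doublings ed en ed
    e = doublings s 1 s
    j = doublings n 2 n
    L = doublings dd dn dd

  depth sample-size run-time : ℕ
  depth       = 1 ℕ.+ a ℕ.+ e
  sample-size = 2 ℕ.^ (1 ℕ.+ a) ℕ.* (7 ℕ.* (s ℕ.* (suc j ℕ.* L)))
  run-time    = 238 ℕ.+ 6 ℕ.* n ℕ.+ 6 ℕ.* s ℕ.+ 21 ℕ.* j ℕ.+ 15 ℕ.* L ℕ.+ 39 ℕ.* a ℕ.+ 15 ℕ.* e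
                ℕ.+ sample-size ℕ.* (n ℕ.+ 6) ℕ.+ learn-time n sample-size depth
  inputs : Env n Inputs
  inputs = allFin n ∷ s ∷ en ∷ ed ∷ dn ∷ dd ∷ []

  learner-draws :
    Draws run-time sample-size
      (λ xs h → h ≡ proj₂ (learn (allFin n) s depth (label f xs)))
      (eval f learner inputs)
  learner-draws = weakenᵈ
    (ℕ.≤-reflexive (lem n s j L a e (sample-size ℕ.* (n ℕ.+ 6)) (learn-time n sample-size depth)))
    (delayᵈ 1 (bindᵈ
      (delayᵈ 1 (bindʸᵈ (run-yields learned) (λ g h →
        bindᵈ {Q = λ xs v → v ≡ learn (allFin n) s depth (label f xs)} {g = g}
          (sample-draws sample-size-evals)
          (λ { xs _ (refl , eq) →
            weakenʸ (ℕ.≤-reflexive (cong (λ k → learn-time k sample-size depth) length-allFin))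
                    (λ p → p)
                    (h (label f xs) (label f xs) refl
                       (ℕ.≤-reflexive (trans (List.length-map _ xs) eq))) }))))
      (λ { xs _ refl → yields ℕ.≤-refl refl })))
    where
    length-allFin : length (allFin n) ≡ n
    length-allFin = List.length-tabulate (λ i → i)
    tolerance-evals : Evals f inputs tolerance-exponentᵗ (27 ℕ.+ 15 ℕ.* a) (_≡ a)
    tolerance-evals = doublings-evals (computes refl) (computes refl)
    depth-evals : Evals f inputs depthᵗ (57 ℕ.+ 15 ℕ.* a ℕ.+ 15 ℕ.* e) (_≡ depth)
    depth-evals = weaken
      (add-evals (add-evals (computes refl) tolerance-evals)
                 (doublings-evals (computes refl) (computes refl)))
      (ℕ.≤-reflexive (lem′ a e))
      where
      lem′ : ∀ a e → 1 ℕ.+ (1 ℕ.+ (1 ℕ.+ (27 ℕ.+ 15 ℕ.* a ℕ.+ 0)) ℕ.+ (27 ℕ.+ 15 ℕ.* e ℕ.+ 0))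
                   ≡ 57 ℕ.+ 15 ℕ.* a ℕ.+ 15 ℕ.* e
      lem′ = solve-∀
    learned : Evals f inputs (learnᵗ depthᵗ) (60 ℕ.+ 15 ℕ.* a ℕ.+ 15 ℕ.* e)
      (Learns sample-size (learn-time (length (allFin n)) sample-size depth)
              (learn (allFin n) s depth))
    learned = learn-evals (allFin n) s depth-evals
    log-n-evals : Evals f inputs log-nᵗ (32 ℕ.+ 6 ℕ.* n ℕ.+ 15 ℕ.* j) (_≡ suc j)
    log-n-evals = weaken
      (add-evals (computes refl)
        (doublings-evals (recast (length-evals (computes refl)) length-allFin) (computes refl)))
      (ℕ.≤-reflexive (trans
        (cong (λ k → 2 ℕ.+ (25 ℕ.+ (4 ℕ.+ 6 ℕ.* k ℕ.+ 1 ℕ.+ 15 ℕ.* j) ℕ.+ 0)) length-allFin)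
        (lem′ n j)))
      where
      lem′ : ∀ n j → 2 ℕ.+ (25 ℕ.+ (4 ℕ.+ 6 ℕ.* n ℕ.+ 1 ℕ.+ 15 ℕ.* j) ℕ.+ 0)
                   ≡ 32 ℕ.+ 6 ℕ.* n ℕ.+ 15 ℕ.* j
      lem′ = solve-∀
    sample-size-evals : Evals f inputs sample-sizeᵗ
      (173 ℕ.+ 6 ℕ.* n ℕ.+ 6 ℕ.* s ℕ.+ 21 ℕ.* j ℕ.+ 15 ℕ.* L ℕ.+ 24 ℕ.* a) (_≡ sample-size)
    sample-size-evals = weaken
      (double-evals
        (times-evals (computes refl)
          (times-evals (computes refl)
            (times-evals log-n-evals (doublings-evals (computes refl) (computes refl)))))
        (add-evals (computes refl) tolerance-evals))
      (ℕ.≤-reflexive (lem′ n s j L a))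
      where
      lem′ : ∀ n s j L a →
        2 ℕ.+ (8 ℕ.+ (1 ℕ.+ (8 ℕ.+ (1 ℕ.+ (8 ℕ.+ (32 ℕ.+ 6 ℕ.* n ℕ.+ 15 ℕ.* j ℕ.+ (27 ℕ.+ 15 ℕ.* L)
          ℕ.+ 6 ℕ.* suc j)) ℕ.+ 6 ℕ.* s)) ℕ.+ 42) ℕ.+ (2 ℕ.+ (27 ℕ.+ 15 ℕ.* a ℕ.+ 0)) ℕ.+ 9 ℕ.* suc a)
        ≡ 173 ℕ.+ 6 ℕ.* n ℕ.+ 6 ℕ.* s ℕ.+ 21 ℕ.* j ℕ.+ 15 ℕ.* L ℕ.+ 24 ℕ.* a
      lem′ = solve-∀
    lem : ∀ n s j L a e X T →
      1 ℕ.+ (1 ℕ.+ (60 ℕ.+ 15 ℕ.* a ℕ.+ 15 ℕ.* e ℕ.+ (1 ℕ.+ (173 ℕ.+ 6 ℕ.* n ℕ.+ 6 ℕ.* s ℕ.+ 21 ℕ.* j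
        ℕ.+ 15 ℕ.* L ℕ.+ 24 ℕ.* a ℕ.+ (2 ℕ.+ X)) ℕ.+ T)) ℕ.+ 0)
      ≡ 238 ℕ.+ 6 ℕ.* n ℕ.+ 6 ℕ.* s ℕ.+ 21 ℕ.* j ℕ.+ 15 ℕ.* L ℕ.+ 39 ℕ.* a ℕ.+ 15 ℕ.* e ℕ.+ X ℕ.+ T
    lem = solve-∀

-- Correctness of the learner

null-true : {A : Set} (xs : List A) {x : A} → null xs ≡ true → ¬ x ∈ xs
null-true [] _ ()

null-false : {A : Set} (xs : List A) → null xs ≡ false → ∃[ x ] x ∈ xs
null-false (x ∷ xs) _ = x , here refl

module _ {A : Set} (π : A → Bool) where

  ∈-filterᵇ⁺ : ∀ {x xs} → x ∈ xs → π x ≡ true → x ∈ filterᵇ π xs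
  ∈-filterᵇ⁺ x∈ eq = ∈.∈-filter⁺ (λ y → Bool.T? (π y)) x∈ (subst T (sym eq) tt)

  ∈-filterᵇ⁻ : ∀ {x xs} → x ∈ filterᵇ π xs → x ∈ xs × π x ≡ true
  ∈-filterᵇ⁻ {xs = xs} x∈ with ∈.∈-filter⁻ (λ y → Bool.T? (π y)) {xs = xs} x∈
  ... | x∈xs , Tπ = x∈xs , T-≡ Tπ
    where
    T-≡ : ∀ {b} → T b → b ≡ true
    T-≡ {true} _ = refl

if-flip : ∀ b → (if b then false else true) ≡ true → b ≡ false
if-flip false _ = refl

if-flip′ : ∀ {b} → b ≡ false → (if b then false else true) ≡ true
if-flip′ refl = refl

1≤size : ∀ {n} (t : DT n) → 1 ℕ.≤ size t
1≤size (leaf _)       = ℕ.≤-refl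
1≤size (node _ t₀ t₁) = ℕ.≤-trans (1≤size t₀) (ℕ.m≤m+n _ _)

module _ {n : ℕ} where

  Fits : DT n → List (Example n) → Set
  Fits t S = ∀ {e} → e ∈ S → compute t (proj₁ e) ≡ proj₂ e

  -- A path which is cut at the given depth counts as correct.
  wrong : (depth : ℕ) → DT n → Point n → Bool → Bool
  wrong zero    t              x b = false
  wrong (suc d) (leaf c)       x b = does (¬? (c Bool.≟ b))
  wrong (suc d) (node i t₀ t₁) x b =
    if Vec.lookup x i then wrong d t₁ x b else wrong d t₀ x b

  Occurs : Fin n → DT n → Set
  Occurs i (leaf _)       = ⊥
  Occurs i (node j t₀ t₁) = i ≡ j ⊎ Occurs i t₀ ⊎ Occurs i t₁

  ReadOnce : DT n → Set
  ReadOnce (leaf _)       = ⊤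
  ReadOnce (node i t₀ t₁) = ¬ Occurs i t₀ × ¬ Occurs i t₁ × ReadOnce t₀ × ReadOnce t₁

  zeros-fit : ∀ {i t₀ t₁ S} → Fits (node i t₀ t₁) S → Fits t₀ (zeros i S)
  zeros-fit {i} {t₀} {t₁} fit {x , b} e∈ with ∈-filterᵇ⁻ (zero? i) e∈
  ... | e∈S , eq = trans (cong (λ c → if c then compute t₁ x else compute t₀ x)
                               (sym (if-flip _ eq))) (fit e∈S)

  ones-fit : ∀ {i t₀ t₁ S} → Fits (node i t₀ t₁) S → Fits t₁ (ones i S)
  ones-fit {i} {t₀} {t₁} fit {x , b} e∈ with ∈-filterᵇ⁻ (one? i) e∈
  ... | e∈S , eq = trans (cong (λ c → if c then compute t₁ x else compute t₀ x)
                               (sym eq)) (fit e∈S)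

  no-zeros : ∀ (i : Fin n) {S} → null (zeros i S) ≡ true → ∀ {e} → e ∈ S → Vec.lookup (proj₁ e) i ≡ true
  no-zeros i {S} none {e} e∈ with Vec.lookup (proj₁ e) i in eq
  ... | true  = refl
  ... | false = ⊥-elim (null-true (zeros i S) none (∈-filterᵇ⁺ (zero? i) e∈ (if-flip′ eq)))

  no-ones : ∀ (i : Fin n) {S} → null (ones i S) ≡ true → ∀ {e} → e ∈ S → Vec.lookup (proj₁ e) i ≡ false
  no-ones i {S} none {e} e∈ with Vec.lookup (proj₁ e) i in eq
  ... | false = refl
  ... | true  = ⊥-elim (null-true (ones i S) none (∈-filterᵇ⁺ (one? i) e∈ eq))

  better-≤ : ∀ (i : Fin n) (A B R : ℕ × DT n) → proj₁ (better i A B R) ℕ.≤ proj₁ A ℕ.+ proj₁ B ×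
                         proj₁ (better i A B R) ℕ.≤ proj₁ R
  better-≤ i (k₀ , _) (k₁ , _) (k , _) with k₀ ℕ.+ k₁ ℕ.≤? k
  ... | yes p with k₀ ℕ.+ k₁ ℕ.≤ᵇ k | ℕ.≤⇒≤ᵇ p
  ...   | true | _ = ℕ.≤-refl , p
  better-≤ i (k₀ , _) (k₁ , _) (k , _) | no ¬p with k₀ ℕ.+ k₁ ℕ.≤ᵇ k in eq
  ...   | true  = ⊥-elim (¬p (ℕ.≤ᵇ⇒≤ _ _ (subst T (sym eq) tt)))
  ...   | false = ℕ.≰⇒≥ ¬p , ℕ.≤-refl

  best-≤-tail : ∀ (L : List (Example n) → ℕ × DT n) s S i is → proj₁ (best L s S (i ∷ is)) ℕ.≤ proj₁ (best L s S is)
  best-≤-tail L s S i is with null (zeros i S)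
  ... | true = ℕ.≤-refl
  ... | false with null (ones i S)
  ...   | true  = ℕ.≤-refl
  ...   | false = proj₂ (better-≤ i (L (zeros i S)) (L (ones i S)) (best L s S is))

  best-≤ : ∀ (L : List (Example n) → ℕ × DT n) s S {i is} → i ∈ is → null (zeros i S) ≡ false → null (ones i S) ≡ false →
           proj₁ (best L s S is) ℕ.≤ proj₁ (L (zeros i S)) ℕ.+ proj₁ (L (ones i S))
  best-≤ L s S {i} {_ ∷ is} (here refl) z o rewrite z | o =
    proj₁ (better-≤ i (L (zeros i S)) (L (ones i S)) (best L s S is))
  best-≤ L s S {i} {j ∷ is} (there i∈) z o =
    ℕ.≤-trans (best-≤-tail L s S j is) (best-≤ L s S i∈ z o)

  -- Induction on the depth, with an inner induction `go` on the fitting tree. A root that does not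
  -- split the sample is skipped in favour of the child on the nonempty side. A splitting root is
  -- among the candidates of `best`, and its children fit the two parts. At depth 0 the claimed size
  -- is 1.
  learn-≤ : ∀ {is s} → (∀ (i : Fin n) → i ∈ is) → ∀ d t {S} → Fits t S →
            proj₁ (learn is s d S) ℕ.≤ size t
  learn-≤ all zero    t fit = 1≤size t
  learn-≤ {is} {s} all (suc d) t {S} fit with null (filterᵇ proj₂ S) in eq₁
  ... | true = 1≤size t
  ... | false with null (filterᵇ negative? S) in eq₂
  ...   | true  = 1≤size t
  ...   | false = go t fit
    where
    impure : ∀ {c} → Fits (leaf c) S → ⊥
    impure fit with null-false (filterᵇ proj₂ S) eq₁
                  | null-false (filterᵇ negative? S) eq₂
    ... | e , e∈ | e′ , e′∈ with ∈-filterᵇ⁻ proj₂ e∈ | ∈-filterᵇ⁻ negative? e′∈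
    ...   | e∈S , p | e′∈S , q =
      case trans (sym p) (trans (sym (fit e∈S)) (trans (fit e′∈S) (if-flip _ q))) of λ ()
    go : ∀ t → Fits t S → proj₁ (best (learn is s d) s S is) ℕ.≤ size t
    go (leaf c) fit = ⊥-elim (impure fit)
    go (node i t₀ t₁) fit with null (zeros i S) in z | null (ones i S) in o
    ... | true  | _    = ℕ.≤-trans (go t₁ (λ {e} e∈ →
      trans (cong (λ c → if c then compute t₁ (proj₁ e) else compute t₀ (proj₁ e))
                  (sym (no-zeros i {S} z e∈))) (fit e∈)))
      (ℕ.m≤n+m _ (size t₀))
    ... | false | true = ℕ.≤-trans (go t₀ (λ {e} e∈ →
      trans (cong (λ c → if c then compute t₁ (proj₁ e) else compute t₀ (proj₁ e))
                  (sym (no-ones i {S} o e∈))) (fit e∈)))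
      (ℕ.m≤m+n (size t₀) _)
    ... | false | false = ℕ.≤-trans (best-≤ (learn is s d) s S (all i) z o)
      (ℕ.+-mono-≤ (learn-≤ all d t₀ (zeros-fit {i} {t₀} {t₁} fit))
                  (learn-≤ all d t₁ (ones-fit {i} {t₀} {t₁} fit)))

  -- `splits` is carried along to make `read-once` inductive: a variable that occurs below a test of
  -- i splits a subsample on which bit i is constant, so it differs from i. The last two fields are
  -- conditional because a failed search returns a leaf that may contradict the sample.
  record Sound (s d : ℕ) (S : List (Example n)) (r : ℕ × DT n) : Set where
    field
      read-once  : ReadOnce (proj₂ r)
      splits     : ∀ i → Occurs i (proj₂ r) → (∃[ e ] e ∈ zeros i S) × (∃[ e ] e ∈ ones i S)
      bounded    : proj₁ r ℕ.≤ s → size (proj₂ r) ℕ.≤ proj₁ r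
      consistent : proj₁ r ℕ.≤ s → ∀ {e} → e ∈ S → wrong d (proj₂ r) (proj₁ e) (proj₂ e) ≡ false
  open Sound

  better-sound : ∀ {s d S i A B R} →
    ∃[ e ] e ∈ zeros i S → ∃[ e ] e ∈ ones i S →
    Sound s d (zeros i S) A → Sound s d (ones i S) B → Sound s (suc d) S R →
    Sound s (suc d) S (better i A B R)
  better-sound {s} {d} {S} {i} {k₀ , t₀} {k₁ , t₁} {k , t} z o hA hB hR
    with k₀ ℕ.+ k₁ ℕ.≤ᵇ k
  ... | false = hR
  ... | true  = record
    { read-once = (λ occ → case splits hA i occ of λ { (_ , e , e∈) → no-one e∈ })
                , (λ occ → case splits hB i occ of λ { ((e , e∈) , _) → no-zero e∈ })
                , read-once hA , read-once hB
    ; splits = λ { j (inj₁ refl) → z , o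
                 ; j (inj₂ (inj₁ occ)) → case splits hA j occ of λ
                     { ((e , e∈) , (e′ , e′∈)) → (e , widen (zero? j) (zero? i) e∈) , (e′ , widen (one? j) (zero? i) e′∈) }
                 ; j (inj₂ (inj₂ occ)) → case splits hB j occ of λ
                     { ((e , e∈) , (e′ , e′∈)) → (e , widen (zero? j) (one? i) e∈) , (e′ , widen (one? j) (one? i) e′∈) } }
    ; bounded = λ k≤s → ℕ.+-mono-≤ (bounded hA (≤₀ k≤s)) (bounded hB (≤₁ k≤s))
    ; consistent = λ k≤s {e} e∈ → follow k≤s e∈ (Vec.lookup (proj₁ e) i) refl
    }
    where
    ≤₀ : k₀ ℕ.+ k₁ ℕ.≤ s → k₀ ℕ.≤ s
    ≤₀ = ℕ.≤-trans (ℕ.m≤m+n k₀ k₁)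
    ≤₁ : k₀ ℕ.+ k₁ ℕ.≤ s → k₁ ℕ.≤ s
    ≤₁ = ℕ.≤-trans (ℕ.m≤n+m k₁ k₀)
    widen : ∀ (π σ : Example n → Bool) {e} → e ∈ filterᵇ π (filterᵇ σ S) → e ∈ filterᵇ π S
    widen π σ e∈ with ∈-filterᵇ⁻ π {xs = filterᵇ σ S} e∈
    ... | e∈′ , eq = ∈-filterᵇ⁺ π (proj₁ (∈-filterᵇ⁻ σ {xs = S} e∈′)) eq
    clash : ∀ {e} → zero? i e ≡ true → one? i e ≡ true → ⊥
    clash {x , _} z≡ o≡ = case trans (sym o≡) (if-flip (Vec.lookup x i) z≡) of λ ()
    no-one : ∀ {e} → e ∈ ones i (zeros i S) → ⊥
    no-one {e} e∈ with ∈-filterᵇ⁻ (one? i) e∈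
    ... | e∈′ , o≡ = clash {e} (proj₂ (∈-filterᵇ⁻ (zero? i) {xs = S} e∈′)) o≡
    no-zero : ∀ {e} → e ∈ zeros i (ones i S) → ⊥
    no-zero {e} e∈ with ∈-filterᵇ⁻ (zero? i) e∈
    ... | e∈′ , z≡ = clash {e} z≡ (proj₂ (∈-filterᵇ⁻ (one? i) {xs = S} e∈′))
    follow : k₀ ℕ.+ k₁ ℕ.≤ s → ∀ {e} → e ∈ S → ∀ b → Vec.lookup (proj₁ e) i ≡ b →
             (if b then wrong d t₁ (proj₁ e) (proj₂ e) else wrong d t₀ (proj₁ e) (proj₂ e)) ≡ false
    follow k≤s e∈ true  eq = consistent hB (≤₁ k≤s) (∈-filterᵇ⁺ (one? i) e∈ eq)
    follow k≤s e∈ false eq = consistent hA (≤₀ k≤s) (∈-filterᵇ⁺ (zero? i) e∈ (if-flip′ eq))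

  best-sound : ∀ {s d S L} → (∀ S → Sound s d S (L S)) → ∀ is →
               Sound s (suc d) S (best L s S is)
  best-sound hL [] = record
    { read-once  = tt
    ; splits     = λ _ ()
    ; bounded    = λ 1+s≤s → ⊥-elim (ℕ.<-irrefl refl 1+s≤s)
    ; consistent = λ 1+s≤s → ⊥-elim (ℕ.<-irrefl refl 1+s≤s)
    }
  best-sound {S = S} hL (i ∷ is) with null (zeros i S) in z
  ... | true = best-sound hL is
  ... | false with null (ones i S) in o
  ...   | true  = best-sound hL is
  ...   | false = better-sound (null-false (zeros i S) z) (null-false (ones i S) o) (hL _) (hL _) (best-sound hL is)

  leaf-sound : ∀ {s d S c} → (∀ {e} → e ∈ S → c ≡ proj₂ e) → Sound s (suc d) S (1 , leaf c)
  leaf-sound {S = S} {c} pure = record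
    { read-once  = tt
    ; splits     = λ _ ()
    ; bounded    = λ _ → ℕ.≤-refl
    ; consistent = λ _ {e} e∈ → same (pure e∈)
    }
    where
    same : ∀ {b} → c ≡ b → does (¬? (c Bool.≟ b)) ≡ false
    same {false} refl = refl
    same {true}  refl = refl

  learn-sound : ∀ is s d S → Sound s d S (learn is s d S)
  learn-sound is s zero S = record
    { read-once  = tt
    ; splits     = λ _ ()
    ; bounded    = λ _ → ℕ.≤-refl
    ; consistent = λ _ _ → refl
    }
  learn-sound is s (suc d) S with null (filterᵇ proj₂ S) in eq₁
  ... | true = leaf-sound λ { {_ , false} _ → refl
                            ; {_ , true} e∈ → ⊥-elim (null-true (filterᵇ proj₂ S) eq₁ (∈-filterᵇ⁺ proj₂ e∈ refl)) }
  ... | false with null (filterᵇ negative? S) in eq₂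
  ...   | true = leaf-sound λ { {_ , true} _ → refl
                              ; {_ , false} e∈ → ⊥-elim (null-true (filterᵇ negative? S) eq₂ (∈-filterᵇ⁺ negative? e∈ refl)) }
  ...   | false = best-sound (learn-sound is s d) is

-- Rational arithmetic

ℚ-ring : AlmostCommutativeRing _ _
ℚ-ring = fromCommutativeRing ℚ.+-*-commutativeRing (λ p → dec⇒maybe (0ℚ ℚ.≟ p))

fromℕ-+ : ∀ k l → fromℕ (k ℕ.+ l) ≡ fromℕ k + fromℕ l
fromℕ-+ k l = ℚ.toℚᵘ-injective (ℚᵘ.≃-trans (ℚ.toℚᵘ-fromℚᵘ (mkℚᵘ (+ (k ℕ.+ l)) 0)) (ℚᵘ.≃-sym
  (ℚᵘ.≃-trans (ℚ.toℚᵘ-homo-+ (fromℕ k) (fromℕ l))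
  (ℚᵘ.≃-trans (ℚᵘ.+-cong (ℚ.toℚᵘ-fromℚᵘ (mkℚᵘ (+ k) 0)) (ℚ.toℚᵘ-fromℚᵘ (mkℚᵘ (+ l) 0)))
              (*≡* (lem (+ k) (+ l)))))))
  where
  lem : ∀ x y → (x ℤ.* ℤ.1ℤ ℤ.+ y ℤ.* ℤ.1ℤ) ℤ.* ℤ.1ℤ ≡ (x ℤ.+ y) ℤ.* ℤ.1ℤ
  lem = ℤ-Solver.solve-∀

fromℕ-* : ∀ k l → fromℕ (k ℕ.* l) ≡ fromℕ k * fromℕ l
fromℕ-* zero    l = sym (ℚ.*-zeroˡ (fromℕ l))
fromℕ-* (suc k) l = begin
  fromℕ (l ℕ.+ k ℕ.* l)           ≡⟨ fromℕ-+ l (k ℕ.* l) ⟩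
  fromℕ l + fromℕ (k ℕ.* l)       ≡⟨ cong (λ p → fromℕ l + p) (fromℕ-* k l) ⟩
  fromℕ l + fromℕ k * fromℕ l     ≡⟨ lem (fromℕ k) (fromℕ l) ⟩
  (1ℚ + fromℕ k) * fromℕ l        ≡⟨ cong (_* fromℕ l) (sym (fromℕ-+ 1 k)) ⟩
  fromℕ (suc k) * fromℕ l         ∎
  where
  open ≡-Reasoning
  lem : ∀ x y → y + x * y ≡ (1ℚ + x) * y
  lem = Ring.solve-∀ ℚ-ring

fromℕ-mono : ∀ {k l} → k ℕ.≤ l → fromℕ k ≤ fromℕ l
fromℕ-mono {k} {l} k≤l = ℚ.toℚᵘ-cancel-≤ (ℚᵘ.≤-respʳ-≃ (ℚᵘ.≃-sym (ℚ.toℚᵘ-fromℚᵘ (mkℚᵘ (+ l) 0)))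
  (ℚᵘ.≤-respˡ-≃ (ℚᵘ.≃-sym (ℚ.toℚᵘ-fromℚᵘ (mkℚᵘ (+ k) 0)))
    (*≤* (ℤ.*-monoʳ-≤-nonNeg ℤ.1ℤ (ℤ.+≤+ k≤l)))))

0≤fromℕ : ∀ k → 0ℚ ≤ fromℕ k
0≤fromℕ k = fromℕ-mono {0} {k} z≤n

*-mono-≤ : ∀ {p q r s} → 0ℚ ≤ p → 0ℚ ≤ r → p ≤ q → r ≤ s → p * r ≤ q * s
*-mono-≤ {p} {q} {r} {s} 0≤p 0≤r p≤q r≤s = ℚ.≤-trans
  (ℚ.*-monoʳ-≤-nonNeg r {{ℚ.nonNegative 0≤r}} p≤q)
  (ℚ.*-monoˡ-≤-nonNeg q {{ℚ.nonNegative (ℚ.≤-trans 0≤p p≤q)}} r≤s)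

*-nonneg : ∀ {p q} → 0ℚ ≤ p → 0ℚ ≤ q → 0ℚ ≤ p * q
*-nonneg {p} {q} 0≤p 0≤q = subst (_≤ p * q) (ℚ.*-zeroˡ 0ℚ) (*-mono-≤ ℚ.≤-refl ℚ.≤-refl 0≤p 0≤q)

0≤½ : 0ℚ ≤ ½
0≤½ = ℚ.nonNegative⁻¹ ½

0≤1 : 0ℚ ≤ 1ℚ
0≤1 = ℚ.nonNegative⁻¹ 1ℚ

^-nonneg : ∀ {p} k → 0ℚ ≤ p → 0ℚ ≤ p ^ k
^-nonneg zero    0≤p = 0≤1
^-nonneg (suc k) 0≤p = *-nonneg 0≤p (^-nonneg k 0≤p)

^-mono-≤ : ∀ {p q} k → 0ℚ ≤ p → p ≤ q → p ^ k ≤ q ^ k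
^-mono-≤ zero    0≤p p≤q = ℚ.≤-refl
^-mono-≤ (suc k) 0≤p p≤q = *-mono-≤ 0≤p (^-nonneg k 0≤p) p≤q (^-mono-≤ k 0≤p p≤q)

^-+ : ∀ p k l → p ^ (k ℕ.+ l) ≡ p ^ k * p ^ l
^-+ p zero    l = sym (ℚ.*-identityˡ (p ^ l))
^-+ p (suc k) l = trans (cong (λ q → p * q) (^-+ p k l)) (sym (ℚ.*-assoc p (p ^ k) (p ^ l)))

^-* : ∀ p k l → p ^ (k ℕ.* l) ≡ (p ^ l) ^ k
^-* p zero    l = refl
^-* p (suc k) l = trans (^-+ p l (k ℕ.* l)) (cong (λ q → p ^ l * q) (^-* p k l))

*-^ : ∀ p q k → (p * q) ^ k ≡ p ^ k * q ^ k
*-^ p q zero    = refl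
*-^ p q (suc k) = trans (cong (λ r → p * q * r) (*-^ p q k)) (lem p q (p ^ k) (q ^ k))
  where
  lem : ∀ a b c d → a * b * (c * d) ≡ a * c * (b * d)
  lem = Ring.solve-∀ ℚ-ring

fromℕ-^ : ∀ k l → fromℕ (k ℕ.^ l) ≡ fromℕ k ^ l
fromℕ-^ k zero    = refl
fromℕ-^ k (suc l) = trans (fromℕ-* k (k ℕ.^ l)) (cong (λ p → fromℕ k * p) (fromℕ-^ k l))

2^k*½^k≡1 : ∀ k → fromℕ (2 ℕ.^ k) * ½ ^ k ≡ 1ℚ
2^k*½^k≡1 k = trans (cong (_* ½ ^ k) (fromℕ-^ 2 k)) (trans (sym (*-^ (fromℕ 2) ½ k)) (one k))
  where
  one : ∀ k → 1ℚ ^ k ≡ 1ℚ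
  one zero    = refl
  one (suc k) = trans (ℚ.*-identityˡ (1ℚ ^ k)) (one k)

-- Expectations

𝔼-mono : ∀ {n} {g h : Point n → ℚ} → (∀ x → g x ≤ h x) → 𝔼 g ≤ 𝔼 h
𝔼-mono {zero}  g≤h = g≤h []
𝔼-mono {suc n} g≤h = ℚ.*-monoˡ-≤-nonNeg ½
  (ℚ.+-mono-≤ (𝔼-mono (λ x → g≤h (false ∷ x))) (𝔼-mono (λ x → g≤h (true ∷ x))))

𝔼-cong : ∀ {n} {g h : Point n → ℚ} → (∀ x → g x ≡ h x) → 𝔼 g ≡ 𝔼 h
𝔼-cong g≡h = ℚ.≤-antisym (𝔼-mono (λ x → ℚ.≤-reflexive (g≡h x)))
                         (𝔼-mono (λ x → ℚ.≤-reflexive (sym (g≡h x))))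

𝔼-+ : ∀ {n} (g h : Point n → ℚ) → 𝔼 (λ x → g x + h x) ≡ 𝔼 g + 𝔼 h
𝔼-+ {zero}  g h = refl
𝔼-+ {suc n} g h = trans
  (cong₂ (λ p q → ½ * (p + q)) (𝔼-+ (g ∘ (false ∷_)) (h ∘ (false ∷_)))
                               (𝔼-+ (g ∘ (true ∷_)) (h ∘ (true ∷_))))
  (lem ½ (𝔼 (g ∘ (false ∷_))) _ _ _)
  where
  lem : ∀ h a b c d → h * ((a + b) + (c + d)) ≡ h * (a + c) + h * (b + d)
  lem = Ring.solve-∀ ℚ-ring

𝔼-*ˡ : ∀ {n} c (g : Point n → ℚ) → 𝔼 (λ x → c * g x) ≡ c * 𝔼 g
𝔼-*ˡ {zero}  c g = refl
𝔼-*ˡ {suc n} c g = trans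
  (cong₂ (λ p q → ½ * (p + q)) (𝔼-*ˡ c (g ∘ (false ∷_))) (𝔼-*ˡ c (g ∘ (true ∷_))))
  (lem ½ c _ _)
  where
  lem : ∀ h c a b → h * (c * a + c * b) ≡ c * (h * (a + b))
  lem = Ring.solve-∀ ℚ-ring

average : ∀ p → ½ * (p + p) ≡ p
average p = trans (lem ½ p) (ℚ.*-identityˡ p)
  where
  lem : ∀ h p → h * (p + p) ≡ (h + h) * p
  lem = Ring.solve-∀ ℚ-ring

𝔼-const : ∀ {n} c → 𝔼 {n} (λ _ → c) ≡ c
𝔼-const {zero}  c = refl
𝔼-const {suc n} c = trans (cong₂ (λ p q → ½ * (p + q)) (𝔼-const {n} c) (𝔼-const {n} c)) (average c)

-- Conditioning on bit i by overwriting it. The expectation still ranges over all n bits, so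
-- subtrees need no reindexing.
𝔼-split : ∀ {n} (i : Fin n) (g : Point n → ℚ) →
          𝔼 g ≡ ½ * (𝔼 (λ x → g (x Vec.[ i ]≔ false)) + 𝔼 (λ x → g (x Vec.[ i ]≔ true)))
𝔼-split {suc n} Fin.zero g = cong₂ (λ p q → ½ * (p + q))
  (sym (average (𝔼 (λ x → g (false ∷ x))))) (sym (average (𝔼 (λ x → g (true ∷ x)))))
𝔼-split {suc n} (Fin.suc i) g = trans
  (cong₂ (λ p q → ½ * (p + q)) (𝔼-split i (g ∘ (false ∷_))) (𝔼-split i (g ∘ (true ∷_))))
  (lem ½ (𝔼 (λ x → g (false ∷ x Vec.[ i ]≔ false))) (𝔼 (λ x → g (false ∷ x Vec.[ i ]≔ true)))
         (𝔼 (λ x → g (true ∷ x Vec.[ i ]≔ false))) (𝔼 (λ x → g (true ∷ x Vec.[ i ]≔ true))))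
  where
  lem : ∀ h a b c d → h * (h * (a + b) + h * (c + d)) ≡ h * (h * (a + c) + h * (b + d))
  lem = Ring.solve-∀ ℚ-ring

-- The error of a read-once tree

bitℚ : Bool → ℚ
bitℚ b = if b then 1ℚ else 0ℚ

0≤bitℚ : ∀ b → 0ℚ ≤ bitℚ b
0≤bitℚ false = ℚ.≤-refl
0≤bitℚ true  = 0≤1

bitℚ≤1 : ∀ b → bitℚ b ≤ 1ℚ
bitℚ≤1 false = 0≤1
bitℚ≤1 true  = ℚ.≤-refl

bitℚ-not : ∀ b → bitℚ (not b) + bitℚ b ≡ 1ℚ
bitℚ-not false = refl
bitℚ-not true  = refl

module _ {n : ℕ} where

  -- The region in which `wrong d` is cut. A leaf at depth exactly d is included, to agree with
  -- `wrong`.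
  deep : (d : ℕ) → DT n → Point n → Bool
  deep zero    t              x = true
  deep (suc d) (leaf c)       x = false
  deep (suc d) (node i t₀ t₁) x = if Vec.lookup x i then deep d t₁ x else deep d t₀ x

  error≤wrong+deep : ∀ d t x b →
    bitℚ (does (¬? (compute t x Bool.≟ b))) ≤ bitℚ (wrong d t x b) + bitℚ (deep d t x)
  error≤wrong+deep zero    t        x b = ℚ.≤-trans (bitℚ≤1 _) (ℚ.≤-reflexive (sym (ℚ.+-identityˡ 1ℚ)))
  error≤wrong+deep (suc d) (leaf c) x b = ℚ.≤-reflexive (sym (ℚ.+-identityʳ _))
  error≤wrong+deep (suc d) (node i t₀ t₁) x b with Vec.lookup x i
  ... | true  = error≤wrong+deep d t₁ x b
  ... | false = error≤wrong+deep d t₀ x b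

  -- Reading each variable once enters here: fixing the bit tested at the root leaves the event in
  -- the subtrees unchanged, so they still see a uniform point.
  deep-set : ∀ {i} d t b x → ¬ Occurs i t → deep d t (x Vec.[ i ]≔ b) ≡ deep d t x
  deep-set zero    t        b x ¬occ = refl
  deep-set (suc d) (leaf c) b x ¬occ = refl
  deep-set {i} (suc d) (node j t₀ t₁) b x ¬occ
    rewrite Vec.lookup∘update′ {i = j} {j = i} (λ j≡i → ¬occ (inj₁ (sym j≡i))) x b
          | deep-set {i} d t₀ b x (λ occ → ¬occ (inj₂ (inj₁ occ)))
          | deep-set {i} d t₁ b x (λ occ → ¬occ (inj₂ (inj₂ occ))) = refl

  -- At most `size t` subtrees hang at depth d, and each is reached with probability 2^-d. In the
  -- induction the root halves the probability and the sizes of its children add up.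
  Pr-deep : ∀ d t → ReadOnce t → 𝔼 (λ x → bitℚ (deep d t x)) ≤ fromℕ (size t) * ½ ^ d
  Pr-deep zero t _ = ℚ.≤-trans (ℚ.≤-reflexive (𝔼-const {n} 1ℚ))
    (ℚ.≤-trans (fromℕ-mono (1≤size t)) (ℚ.≤-reflexive (sym (ℚ.*-identityʳ _))))
  Pr-deep (suc d) (leaf c) _ = ℚ.≤-trans (ℚ.≤-reflexive (𝔼-const {n} 0ℚ))
    (*-nonneg 0≤1 (^-nonneg (suc d) 0≤½))
  Pr-deep (suc d) (node i t₀ t₁) (¬occ₀ , ¬occ₁ , ro₀ , ro₁) = begin
    𝔼 (λ x → bitℚ (deep (suc d) (node i t₀ t₁) x))
      ≡⟨ 𝔼-split i _ ⟩
    ½ * (𝔼 (λ x → bitℚ (deep (suc d) (node i t₀ t₁) (x Vec.[ i ]≔ false)))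
       + 𝔼 (λ x → bitℚ (deep (suc d) (node i t₀ t₁) (x Vec.[ i ]≔ true))))
      ≡⟨ cong₂ (λ p q → ½ * (p + q)) (𝔼-cong (λ x → cong bitℚ (left x))) (𝔼-cong (λ x → cong bitℚ (right x))) ⟩
    ½ * (𝔼 (λ x → bitℚ (deep d t₀ x)) + 𝔼 (λ x → bitℚ (deep d t₁ x)))
      ≤⟨ ℚ.*-monoˡ-≤-nonNeg ½ (ℚ.+-mono-≤ (Pr-deep d t₀ ro₀) (Pr-deep d t₁ ro₁)) ⟩
    ½ * (fromℕ (size t₀) * ½ ^ d + fromℕ (size t₁) * ½ ^ d)
      ≡⟨ lem ½ (fromℕ (size t₀)) (fromℕ (size t₁)) (½ ^ d) ⟩
    (fromℕ (size t₀) + fromℕ (size t₁)) * ½ ^ suc d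
      ≡⟨ cong (_* ½ ^ suc d) (sym (fromℕ-+ (size t₀) (size t₁))) ⟩
    fromℕ (size t₀ ℕ.+ size t₁) * ½ ^ suc d ∎
    where
    open ℚ.≤-Reasoning
    lem : ∀ h a b c → h * (a * c + b * c) ≡ (a + b) * (h * c)
    lem = Ring.solve-∀ ℚ-ring
    left : ∀ x → deep (suc d) (node i t₀ t₁) (x Vec.[ i ]≔ false) ≡ deep d t₀ x
    left x rewrite Vec.lookup∘update i x false = deep-set {i} d t₀ false x ¬occ₀
    right : ∀ x → deep (suc d) (node i t₀ t₁) (x Vec.[ i ]≔ true) ≡ deep d t₁ x
    right x rewrite Vec.lookup∘update i x true = deep-set {i} d t₁ true x ¬occ₁

  -- Let W be the probability that `wrong d` holds. Errors lie in `wrong` or in `deep`, so ε ≤ W +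
  -- ν; with 2ν ≤ ε this gives ν ≤ W.
  Pr-not-wrong : ∀ {s d t ν ε} (f : Point n → Bool) →
    ReadOnce t → size t ℕ.≤ s → fromℕ s * ½ ^ d ≤ ν → ν + ν ≤ ε →
    ¬ error (compute t) f ≤ ε → 𝔼 (λ x → bitℚ (not (wrong d t x (f x)))) ≤ 1ℚ - ν
  Pr-not-wrong {s} {d} {t} {ν} {ε} f ro size≤s s≤ν 2ν≤ε err = begin
    N                          ≡⟨ lem₁ N W ν ⟩
    (N + W) - ν + (ν - W)      ≤⟨ ℚ.+-monoʳ-≤ (N + W - ν) ν-W≤0 ⟩
    (N + W) - ν + 0ℚ           ≡⟨ ℚ.+-identityʳ (N + W - ν) ⟩
    (N + W) - ν                ≡⟨ cong (_- ν) N+W≡1 ⟩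
    1ℚ - ν                     ∎
    where
    open ℚ.≤-Reasoning
    N W : ℚ
    N = 𝔼 (λ x → bitℚ (not (wrong d t x (f x))))
    W = 𝔼 (λ x → bitℚ (wrong d t x (f x)))
    N+W≡1 : N + W ≡ 1ℚ
    N+W≡1 = trans (sym (𝔼-+ (λ x → bitℚ (not (wrong d t x (f x)))) (λ x → bitℚ (wrong d t x (f x)))))
      (trans (𝔼-cong (λ x → bitℚ-not (wrong d t x (f x)))) (𝔼-const {n} 1ℚ))
    lem₁ : ∀ a b c → a ≡ (a + b) - c + (c - b)
    lem₁ = Ring.solve-∀ ℚ-ring
    lem₂ : ∀ a b → a - b ≡ (a + a) - (b + a)
    lem₂ = Ring.solve-∀ ℚ-ring
    ε≤W+ν : ε ≤ W + ν
    ε≤W+ν = begin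
      ε                 ≤⟨ ℚ.<⇒≤ (ℚ.≰⇒> err) ⟩
      error (compute t) f
        ≤⟨ 𝔼-mono (λ x → error≤wrong+deep d t x (f x)) ⟩
      𝔼 (λ x → bitℚ (wrong d t x (f x)) + bitℚ (deep d t x))
        ≡⟨ 𝔼-+ (λ x → bitℚ (wrong d t x (f x))) (λ x → bitℚ (deep d t x)) ⟩
      W + 𝔼 (λ x → bitℚ (deep d t x))
        ≤⟨ ℚ.+-monoʳ-≤ W (Pr-deep d t ro) ⟩
      W + fromℕ (size t) * ½ ^ d
        ≤⟨ ℚ.+-monoʳ-≤ W (ℚ.*-monoʳ-≤-nonNeg (½ ^ d) {{ℚ.nonNegative (^-nonneg d 0≤½)}} (fromℕ-mono size≤s)) ⟩
      W + fromℕ s * ½ ^ d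
        ≤⟨ ℚ.+-monoʳ-≤ W s≤ν ⟩
      W + ν ∎
    ν-W≤0 : ν - W ≤ 0ℚ
    ν-W≤0 = begin
      ν - W              ≡⟨ lem₂ ν W ⟩
      (ν + ν) - (W + ν)  ≤⟨ ℚ.+-monoˡ-≤ (- (W + ν)) (ℚ.≤-trans 2ν≤ε ε≤W+ν) ⟩
      (W + ν) - (W + ν)  ≡⟨ ℚ.+-inverseʳ (W + ν) ⟩
      0ℚ                 ∎

-- The union bound

module _ {B : Set} where

  ∑ : List B → (B → ℚ) → ℚ
  ∑ []       g = 0ℚ
  ∑ (b ∷ bs) g = g b + ∑ bs g

  ∑-mono : ∀ bs {g h : B → ℚ} → (∀ b → g b ≤ h b) → ∑ bs g ≤ ∑ bs h
  ∑-mono []       g≤h = ℚ.≤-refl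
  ∑-mono (b ∷ bs) g≤h = ℚ.+-mono-≤ (g≤h b) (∑-mono bs g≤h)

  ∑-nonneg : ∀ bs {g : B → ℚ} → (∀ b → 0ℚ ≤ g b) → 0ℚ ≤ ∑ bs g
  ∑-nonneg []       0≤g = ℚ.≤-refl
  ∑-nonneg (b ∷ bs) 0≤g = ℚ.+-mono-≤ (0≤g b) (∑-nonneg bs 0≤g)

  ∑-member : ∀ {bs} {g : B → ℚ} {b} → (∀ b → 0ℚ ≤ g b) → b ∈ bs → g b ≤ ∑ bs g
  ∑-member {g = g} 0≤g (here {xs = bs} refl) =
    ℚ.≤-trans (ℚ.≤-reflexive (sym (ℚ.+-identityʳ _))) (ℚ.+-monoʳ-≤ (g _) (∑-nonneg bs 0≤g))
  ∑-member {g = g} 0≤g (there b∈) =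
    ℚ.≤-trans (∑-member 0≤g b∈)
      (ℚ.≤-trans (ℚ.≤-reflexive (sym (ℚ.+-identityˡ _))) (ℚ.+-monoˡ-≤ _ (0≤g _)))

  ∑-*ʳ : ∀ bs (g : B → ℚ) p → ∑ bs (λ b → g b * p) ≡ ∑ bs g * p
  ∑-*ʳ []       g p = sym (ℚ.*-zeroˡ p)
  ∑-*ʳ (b ∷ bs) g p = trans (cong (λ q → g b * p + q) (∑-*ʳ bs g p)) (sym (ℚ.*-distribʳ-+ p (g b) (∑ bs g)))

  ∑-1 : ∀ bs → ∑ bs (λ _ → 1ℚ) ≡ fromℕ (length bs)
  ∑-1 []       = refl
  ∑-1 (b ∷ bs) = trans (cong (λ q → 1ℚ + q) (∑-1 bs)) (sym (fromℕ-+ 1 (length bs)))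

  𝔼-∑ : ∀ {n} bs (g : B → Point n → ℚ) → 𝔼 (λ x → ∑ bs (λ b → g b x)) ≡ ∑ bs (λ b → 𝔼 (g b))
  𝔼-∑ {n} []       g = 𝔼-const {n} 0ℚ
  𝔼-∑ {n} (b ∷ bs) g = trans (𝔼-+ (g b) (λ x → ∑ bs (λ b → g b x))) (cong (λ q → 𝔼 (g b) + q) (𝔼-∑ bs g))

∏ : ∀ {X : Set} → (X → ℚ) → List X → ℚ
∏ φ []       = 1ℚ
∏ φ (x ∷ xs) = φ x * ∏ φ xs

-- The induction generalises w = 1: w b is the product of φ b over the points drawn so far.
union-bound : ∀ {n} {A B : Set} (bs : List B) (φ : B → Point n → ℚ) p →
  0ℚ ≤ p → (∀ b x → 0ℚ ≤ φ b x) → (∀ b → 𝔼 (φ b) ≤ p) →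
  ∀ {c m P} {r : Run n A} {Q : A → Set} (Q? : Decidable Q) → Draws c m P r →
  (w : B → ℚ) → (∀ b → 0ℚ ≤ w b) →
  (∀ xs v → P xs v → ¬ Q v → ∃[ b ] b ∈ bs × 1ℚ ≤ w b * ∏ (φ b) xs) →
  1ℚ ≤ Pr r Q? + p ^ m * ∑ bs w
union-bound bs φ p 0≤p 0≤φ Eφ≤p Q? (finished (yields {v = v} _ pv)) w 0≤w fail
  with Q? v
... | yes _ = ℚ.≤-trans (ℚ.≤-reflexive (sym (ℚ.+-identityʳ 1ℚ)))
  (ℚ.+-monoʳ-≤ 1ℚ (*-nonneg 0≤1 (∑-nonneg bs 0≤w)))
... | no ¬q with fail [] v pv ¬q
...   | b , b∈ , 1≤ = begin
  1ℚ                    ≤⟨ 1≤ ⟩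
  w b * 1ℚ              ≡⟨ ℚ.*-identityʳ (w b) ⟩
  w b                   ≤⟨ ∑-member 0≤w b∈ ⟩
  ∑ bs w                ≡⟨ sym (ℚ.*-identityˡ (∑ bs w)) ⟩
  1ℚ * ∑ bs w           ≡⟨ sym (ℚ.+-identityˡ (1ℚ * ∑ bs w)) ⟩
  0ℚ + 1ℚ * ∑ bs w      ∎
  where open ℚ.≤-Reasoning
union-bound {n} bs φ p 0≤p 0≤φ Eφ≤p Q? (drawn {m = m} {k = k} h) w 0≤w fail = begin
  1ℚ
    ≡⟨ sym (𝔼-const {n} 1ℚ) ⟩
  𝔼 {n} (λ _ → 1ℚ)
    ≤⟨ 𝔼-mono (λ x → union-bound bs φ p 0≤p 0≤φ Eφ≤p Q? (h x) (λ b → w b * φ b x)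
         (λ b → *-nonneg (0≤w b) (0≤φ b x))
         (λ xs v pv ¬q → case fail (x ∷ xs) v pv ¬q of λ { (b , b∈ , 1≤) →
            b , b∈ , ℚ.≤-trans 1≤ (ℚ.≤-reflexive (sym (ℚ.*-assoc (w b) (φ b x) (∏ (φ b) xs)))) })) ⟩
  𝔼 (λ x → Pr (k x) Q? + p ^ m * ∑ bs (λ b → w b * φ b x))
    ≡⟨ 𝔼-+ (λ x → Pr (k x) Q?) (λ x → p ^ m * ∑ bs (λ b → w b * φ b x)) ⟩
  𝔼 (λ x → Pr (k x) Q?) + 𝔼 (λ x → p ^ m * ∑ bs (λ b → w b * φ b x))
    ≡⟨ cong (λ q → 𝔼 (λ x → Pr (k x) Q?) + q) (trans (𝔼-*ˡ (p ^ m) (λ x → ∑ bs (λ b → w b * φ b x)))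
         (cong (λ q → p ^ m * q) (𝔼-∑ bs (λ b x → w b * φ b x)))) ⟩
  𝔼 (λ x → Pr (k x) Q?) + p ^ m * ∑ bs (λ b → 𝔼 (λ x → w b * φ b x))
    -- In expectation one draw multiplies every weight by at most p. This supplies one factor of the
    -- power of p.
    ≤⟨ ℚ.+-monoʳ-≤ (𝔼 (λ x → Pr (k x) Q?)) (ℚ.*-monoˡ-≤-nonNeg (p ^ m) {{ℚ.nonNegative (^-nonneg m 0≤p)}} (∑-mono bs weight)) ⟩
  𝔼 (λ x → Pr (k x) Q?) + p ^ m * ∑ bs (λ b → w b * p)
    ≡⟨ cong (λ q → 𝔼 (λ x → Pr (k x) Q?) + q) (trans (cong (λ q → p ^ m * q) (∑-*ʳ bs w p)) (lem p (p ^ m) (∑ bs w))) ⟩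
  𝔼 (λ x → Pr (k x) Q?) + p ^ suc m * ∑ bs w ∎
  where
  open ℚ.≤-Reasoning
  lem : ∀ a b c → b * (c * a) ≡ a * b * c
  lem = Ring.solve-∀ ℚ-ring
  weight : ∀ b → 𝔼 (λ x → w b * φ b x) ≤ w b * p
  weight b = ℚ.≤-trans (ℚ.≤-reflexive (𝔼-*ˡ (w b) (φ b)))
    (ℚ.*-monoˡ-≤-nonNeg (w b) {{ℚ.nonNegative (0≤w b)}} (Eφ≤p b))

-- Enumerating the small trees

module _ {n : ℕ} where

  join : Fin n → List (DT n) → List (DT n)
  join i (t₀ ∷ t₁ ∷ ts) = node i t₀ t₁ ∷ ts
  join i ts             = ts

  -- Every stack has exactly 3 + n successors: idle, two leaves and n joins, where a join on too
  -- short a stack does nothing. Hence the count is an exact power, and the idle instruction lets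
  -- shorter programs be padded.
  grow : List (DT n) → List (List (DT n))
  grow ts = ts ∷ (leaf false ∷ ts) ∷ (leaf true ∷ ts) ∷ map (λ i → join i ts) (allFin n)

  -- The stacks reached by at most k instructions in reverse Polish notation.
  forests : ℕ → List (List (DT n))
  forests zero    = [] ∷ []
  forests (suc k) = List.concatMap grow (forests k)

  length-forests : ∀ k → length (forests k) ≡ (3 ℕ.+ n) ℕ.^ k
  length-forests zero    = refl
  length-forests (suc k) = trans (length-grow (forests k)) (trans
    (cong (ℕ._* (3 ℕ.+ n)) (length-forests k)) (ℕ.*-comm ((3 ℕ.+ n) ℕ.^ k) (3 ℕ.+ n)))
    where
    length-grow : ∀ tss → length (List.concatMap grow tss) ≡ length tss ℕ.* (3 ℕ.+ n)
    length-grow []         = refl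
    length-grow (ts ∷ tss) = trans
      (List.length-++ (grow ts))
      (cong₂ (λ k l → 3 ℕ.+ k ℕ.+ l)
        (trans (List.length-map (λ i → join i ts) (allFin n)) (List.length-tabulate (λ i → i)))
        (length-grow tss))

  grow-∈ : ∀ {ts us tss} → ts ∈ tss → us ∈ grow ts → us ∈ List.concatMap grow tss
  grow-∈ ts∈ us∈ = ∈.∈-concatMap⁺ grow (Any.map (λ { refl → us∈ }) ts∈)

  instructions : DT n → ℕ
  instructions (leaf _)       = 1
  instructions (node _ t₀ t₁) = suc (instructions t₀ ℕ.+ instructions t₁)

  -- A binary tree has one internal node fewer than leaves.
  1+instructions : ∀ t → suc (instructions t) ≡ 2 ℕ.* size t
  1+instructions (leaf _)       = refl
  1+instructions (node i t₀ t₁) = trans (lem (instructions t₀) (instructions t₁))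
    (trans (cong₂ ℕ._+_ (1+instructions t₀) (1+instructions t₁)) (sym (ℕ.*-distribˡ-+ 2 (size t₀) (size t₁))))
    where
    lem : ∀ a b → suc (suc (a ℕ.+ b)) ≡ suc a ℕ.+ suc b
    lem = solve-∀

  push-∈ : ∀ t {ts k} → ts ∈ forests k → t ∷ ts ∈ forests (instructions t ℕ.+ k)
  push-∈ (leaf false) ts∈ = grow-∈ ts∈ (there (here refl))
  push-∈ (leaf true)  ts∈ = grow-∈ ts∈ (there (there (here refl)))
  -- The 1-child is pushed first, so that `join` finds the 0-child on top.
  push-∈ (node i t₀ t₁) {ts} {k} ts∈ = grow-∈
    (subst (λ l → t₀ ∷ t₁ ∷ ts ∈ forests l) (sym (ℕ.+-assoc (instructions t₀) (instructions t₁) k))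
           (push-∈ t₀ (push-∈ t₁ ts∈)))
    (there (there (there (∈.∈-map⁺ (λ i → join i (t₀ ∷ t₁ ∷ ts)) (∈.∈-allFin i)))))

  wait-∈ : ∀ {ts} k {l} → ts ∈ forests l → ts ∈ forests (k ℕ.+ l)
  wait-∈ zero    ts∈ = ts∈
  wait-∈ (suc k) ts∈ = grow-∈ (wait-∈ k ts∈) (here refl)

  small-∈ : ∀ t {s} → size t ℕ.≤ s → t ∷ [] ∈ forests (2 ℕ.* s)
  small-∈ t {s} size≤s = subst (λ l → t ∷ [] ∈ forests l) (ℕ.m∸n+n≡m fits)
    (wait-∈ (2 ℕ.* s ℕ.∸ instructions t)
      (subst (λ l → t ∷ [] ∈ forests l) (ℕ.+-identityʳ (instructions t)) (push-∈ t (here refl))))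
    where
    fits : instructions t ℕ.≤ 2 ℕ.* s
    fits = ℕ.≤-trans (ℕ.n≤1+n _) (ℕ.≤-trans (ℕ.≤-reflexive (1+instructions t)) (ℕ.*-monoʳ-≤ 2 size≤s))

-- Bounds on the parameters and on the running time

2^x*[y+y] : ∀ x y → 2 ℕ.^ x ℕ.* (y ℕ.+ y) ≡ 2 ℕ.^ suc x ℕ.* y
2^x*[y+y] x y = lem (2 ℕ.^ x) y
  where
  lem : ∀ p y → p ℕ.* (y ℕ.+ y) ≡ 2 ℕ.* p ℕ.* y
  lem = solve-∀

n<2^n : ∀ n → n ℕ.< 2 ℕ.^ n
n<2^n zero    = s≤s z≤n
n<2^n (suc n) = ℕ.≤-trans (s≤s (n<2^n n)) (ℕ.≤-trans
  (ℕ.+-monoˡ-≤ (2 ℕ.^ n) (ℕ.m^n>0 2 n)) (ℕ.+-monoʳ-≤ (2 ℕ.^ n) (ℕ.m≤m+n _ 0)))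

≤ᵇ-false : ∀ {t a} → (t ℕ.≤ᵇ a) ≡ false → a ℕ.< t
≤ᵇ-false eq = ℕ.≰⇒> (λ t≤a → subst T eq (ℕ.≤⇒≤ᵇ t≤a))

≤ᵇ-true : ∀ {t a} → (t ℕ.≤ᵇ a) ≡ true → t ℕ.≤ a
≤ᵇ-true eq = ℕ.≤ᵇ⇒≤ _ _ (subst T (sym eq) tt)

doublings-reach : ∀ k a t → t ℕ.≤ 2 ℕ.^ k ℕ.* a → t ℕ.≤ 2 ℕ.^ doublings k a t ℕ.* a
doublings-reach zero    a t t≤ = t≤
doublings-reach (suc k) a t t≤ with t ℕ.≤ᵇ a in eq
... | true  = ℕ.≤-trans (≤ᵇ-true eq) (ℕ.m≤m+n a 0)
... | false = subst (t ℕ.≤_) (2^x*[y+y] (doublings k (a ℕ.+ a) t) a)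
  (doublings-reach k (a ℕ.+ a) t (subst (t ℕ.≤_) (sym (2^x*[y+y] k a)) t≤))

doublings-enough : ∀ a t → 1 ℕ.≤ a → t ℕ.≤ 2 ℕ.^ doublings t a t ℕ.* a
doublings-enough a t 1≤a = doublings-reach t a t
  (ℕ.≤-trans (ℕ.<⇒≤ (n<2^n t)) (ℕ.≤-trans (ℕ.≤-reflexive (sym (ℕ.*-identityʳ _))) (ℕ.*-monoʳ-≤ (2 ℕ.^ t) 1≤a)))

-- Every doubling follows a failed test, so the value before the last one is still below t. Running
-- out of fuel only stops the process earlier.
doublings-least : ∀ k a t r → doublings k a t ≡ suc r → 2 ℕ.^ r ℕ.* a ℕ.< t
doublings-least (suc k) a t r eq with t ℕ.≤ᵇ a in t≤a
doublings-least (suc k) a t zero    eq | false = subst (ℕ._< t) (sym (ℕ.+-identityʳ a)) (≤ᵇ-false t≤a)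
doublings-least (suc k) a t (suc r) eq | false = subst (ℕ._< t) (2^x*[y+y] r a)
  (doublings-least k (a ℕ.+ a) t r (ℕ.suc-injective eq))

-- The rounding overshoots by at most a factor 2, since the value before the last doubling was below
-- t. The assumption on a covers the case of no doubling.
doublings-upper : ∀ k a t → a ℕ.≤ 2 ℕ.* t → 2 ℕ.^ doublings k a t ℕ.* a ℕ.≤ 2 ℕ.* t
doublings-upper k a t a≤2t with doublings k a t in eq
... | zero  = ℕ.≤-trans (ℕ.≤-reflexive (ℕ.+-identityʳ a)) a≤2t
... | suc r = ℕ.≤-trans (ℕ.≤-reflexive (ℕ.*-assoc 2 (2 ℕ.^ r) a))
  (ℕ.*-monoʳ-≤ 2 (ℕ.<⇒≤ (doublings-least k a t r eq)))

n≤2^⌈log₂n⌉ : ∀ n → n ℕ.≤ 2 ℕ.^ ⌈log₂ n ⌉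
n≤2^⌈log₂n⌉ = ℕ.<-rec (λ n → n ℕ.≤ 2 ℕ.^ ⌈log₂ n ⌉) step
  where
  step : ∀ n → (∀ {m} → m ℕ.< n → m ℕ.≤ 2 ℕ.^ ⌈log₂ m ⌉) → n ℕ.≤ 2 ℕ.^ ⌈log₂ n ⌉
  step 0 rec = z≤n
  step 1 rec = ℕ.m^n>0 2 ⌈log₂ 1 ⌉
  step n@(suc (suc k)) rec = begin
    n                              ≡⟨ sym (ℕ.⌊n/2⌋+⌈n/2⌉≡n n) ⟩
    ℕ.⌊ n /2⌋ ℕ.+ ℕ.⌈ n /2⌉        ≤⟨ ℕ.+-monoˡ-≤ _ (ℕ.⌊n/2⌋≤⌈n/2⌉ n) ⟩
    ℕ.⌈ n /2⌉ ℕ.+ ℕ.⌈ n /2⌉        ≤⟨ ℕ.+-mono-≤ half half ⟩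
    2 ℕ.^ (⌈log₂ n ⌉ ℕ.∸ 1) ℕ.+ 2 ℕ.^ (⌈log₂ n ⌉ ℕ.∸ 1)
                                   ≡⟨ cong (2 ℕ.^ (⌈log₂ n ⌉ ℕ.∸ 1) ℕ.+_) (sym (ℕ.+-identityʳ _)) ⟩
    2 ℕ.^ suc (⌈log₂ n ⌉ ℕ.∸ 1)    ≡⟨ cong (2 ℕ.^_) (ℕ.m+[n∸m]≡n 1≤log) ⟩
    2 ℕ.^ ⌈log₂ n ⌉                ∎
    where
    open ℕ.≤-Reasoning
    half : ℕ.⌈ n /2⌉ ℕ.≤ 2 ℕ.^ (⌈log₂ n ⌉ ℕ.∸ 1)
    half = subst (λ l → ℕ.⌈ n /2⌉ ℕ.≤ 2 ℕ.^ l) (⌈log₂⌈n/2⌉⌉≡⌈log₂n⌉∸1 n) (rec (ℕ.⌈n/2⌉<n k))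
    1≤log : 1 ℕ.≤ ⌈log₂ n ⌉
    1≤log = ⌈log₂⌉-mono-≤ {2} {n} (s≤s (s≤s z≤n))

2^k<n⇒k<⌈log₂n⌉ : ∀ {k n} → 2 ℕ.^ k ℕ.< n → k ℕ.< ⌈log₂ n ⌉
2^k<n⇒k<⌈log₂n⌉ {k} {n} 2^k<n = ℕ.≰⇒> λ log≤k → ℕ.<-irrefl refl
  (ℕ.<-≤-trans 2^k<n (ℕ.≤-trans (n≤2^⌈log₂n⌉ n) (ℕ.^-monoʳ-≤ 2 log≤k)))

pred<⇒≤ : ∀ {k l} → (∀ r → k ≡ suc r → r ℕ.< l) → k ℕ.≤ l
pred<⇒≤ {zero}  h = z≤n
pred<⇒≤ {suc r} h = h r refl

-- Starting at 2 and adding one keeps the value at least 1 for small n, in the same way as `lg`.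
log-n : ℕ → ℕ
log-n n = suc (doublings n 2 n)

log-n≤lg : ∀ n → log-n n ℕ.≤ lg n
log-n≤lg n with doublings n 2 n in eq
... | zero  = ℕ.m≤m⊔n 1 ⌈log₂ n ⌉
... | suc r = ℕ.≤-trans (2^k<n⇒k<⌈log₂n⌉ {suc r}
  (subst (ℕ._< n) (ℕ.*-comm (2 ℕ.^ r) 2) (doublings-least n 2 n r eq))) (ℕ.m≤n⊔m 1 ⌈log₂ n ⌉)

n≤2^log-n : ∀ n → n ℕ.≤ 2 ℕ.^ log-n n
n≤2^log-n n = subst (n ℕ.≤_) (ℕ.*-comm (2 ℕ.^ doublings n 2 n) 2) (doublings-enough 2 n (s≤s z≤n))

learn-time-≤ : ∀ n m d →
  learn-time n m d ℕ.≤ 67 ℕ.* (suc m ℕ.* suc n) ℕ.* (2 ℕ.* suc n) ℕ.^ d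
learn-time-≤ n m zero = begin
  4                                   ≤⟨ ℕ.≤ᵇ⇒≤ 4 67 tt ⟩
  67                                  ≤⟨ ℕ.*-monoʳ-≤ 67 (s≤s z≤n) ⟩
  67 ℕ.* (suc m ℕ.* suc n)            ≡⟨ sym (ℕ.*-identityʳ _) ⟩
  67 ℕ.* (suc m ℕ.* suc n) ℕ.* 1      ∎
  where open ℕ.≤-Reasoning
learn-time-≤ n m (suc d) = begin
  25 ℕ.+ 26 ℕ.* m ℕ.+ n ℕ.* (67 ℕ.+ 30 ℕ.* m ℕ.+ 2 ℕ.* learn-time n m d)
    -- The added terms complete the cost outside the recursive calls to W = 67 (m + 1)(n + 1), so
    -- that the recurrence reads W + 2n T.
    ≤⟨ ℕ.m≤m+n _ (42 ℕ.+ 41 ℕ.* m ℕ.+ 37 ℕ.* m ℕ.* n) ⟩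
  25 ℕ.+ 26 ℕ.* m ℕ.+ n ℕ.* (67 ℕ.+ 30 ℕ.* m ℕ.+ 2 ℕ.* learn-time n m d)
    ℕ.+ (42 ℕ.+ 41 ℕ.* m ℕ.+ 37 ℕ.* m ℕ.* n)
    ≡⟨ lem₁ n m (learn-time n m d) ⟩
  67 ℕ.* (suc m ℕ.* suc n) ℕ.* 1 ℕ.+ 2 ℕ.* n ℕ.* learn-time n m d
    ≤⟨ ℕ.+-mono-≤ (ℕ.*-monoʳ-≤ W (ℕ.m^n>0 (2 ℕ.* suc n) d)) (ℕ.*-monoʳ-≤ (2 ℕ.* n) (learn-time-≤ n m d)) ⟩
  W ℕ.* K ℕ.+ 2 ℕ.* n ℕ.* (W ℕ.* K)
    ≤⟨ ℕ.m≤m+n _ (W ℕ.* K) ⟩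
  W ℕ.* K ℕ.+ 2 ℕ.* n ℕ.* (W ℕ.* K) ℕ.+ W ℕ.* K
    ≡⟨ lem₂ n W K ⟩
  W ℕ.* (2 ℕ.* suc n ℕ.* K) ∎
  where
  open ℕ.≤-Reasoning
  W K : ℕ
  W = 67 ℕ.* (suc m ℕ.* suc n)
  K = (2 ℕ.* suc n) ℕ.^ d
  lem₁ : ∀ n m t → 25 ℕ.+ 26 ℕ.* m ℕ.+ n ℕ.* (67 ℕ.+ 30 ℕ.* m ℕ.+ 2 ℕ.* t)
         ℕ.+ (42 ℕ.+ 41 ℕ.* m ℕ.+ 37 ℕ.* m ℕ.* n)
       ≡ 67 ℕ.* (suc m ℕ.* suc n) ℕ.* 1 ℕ.+ 2 ℕ.* n ℕ.* t
  lem₁ = solve-∀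
  lem₂ : ∀ n w k → w ℕ.* k ℕ.+ 2 ℕ.* n ℕ.* (w ℕ.* k) ℕ.+ w ℕ.* k ≡ w ℕ.* (2 ℕ.* suc n ℕ.* k)
  lem₂ = solve-∀

*-distrib-^ : ∀ x y k → (x ℕ.* y) ℕ.^ k ≡ x ℕ.^ k ℕ.* y ℕ.^ k
*-distrib-^ x y zero    = refl
*-distrib-^ x y (suc k) = trans (cong (x ℕ.* y ℕ.*_) (*-distrib-^ x y k))
  (lem x y (x ℕ.^ k) (y ℕ.^ k))
  where
  lem : ∀ a b c d → a ℕ.* b ℕ.* (c ℕ.* d) ≡ a ℕ.* c ℕ.* (b ℕ.* d)
  lem = solve-∀

module _ (n s a e j L : ℕ) (1≤s : 1 ℕ.≤ s) (1≤L : 1 ℕ.≤ L)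
         (n≤2^g : n ℕ.≤ 2 ℕ.^ suc j) (2^e≤2s : 2 ℕ.^ e ℕ.≤ 2 ℕ.* s) where

  private
    -- B is a common bound for all summands of the running time: V stands for the sample size, m =
    -- 14 V; P exceeds n; and Z bounds (2 (n + 1))^d, the growth of the search.
    g X V P Z B m d : ℕ
    g = suc j
    X = 2 ℕ.^ a ℕ.* s
    V = X ℕ.* g ℕ.* L
    P = 2 ℕ.^ (2 ℕ.* g)
    Z = (4 ℕ.* X) ℕ.^ (3 ℕ.* g)
    B = V ℕ.* P ℕ.* Z
    m = 2 ℕ.^ (1 ℕ.+ a) ℕ.* (7 ℕ.* (s ℕ.* (g ℕ.* L)))
    d = 1 ℕ.+ a ℕ.+ e

    1≤* : ∀ {x y} → 1 ℕ.≤ x → 1 ℕ.≤ y → 1 ℕ.≤ x ℕ.* y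
    1≤* = ℕ.*-mono-≤

    ≤*ˡ : ∀ {x z} y → 1 ℕ.≤ y → x ℕ.≤ z → x ℕ.≤ z ℕ.* y
    ≤*ˡ {x} {z} y 1≤y x≤z = ℕ.≤-trans (ℕ.≤-reflexive (sym (ℕ.*-identityʳ x))) (ℕ.*-mono-≤ x≤z 1≤y)

    ≤*ʳ : ∀ {x z} y → 1 ℕ.≤ y → x ℕ.≤ z → x ℕ.≤ y ℕ.* z
    ≤*ʳ {x} {z} y 1≤y x≤z = subst (x ℕ.≤_) (ℕ.*-comm z y) (≤*ˡ y 1≤y x≤z)

    1≤X : 1 ℕ.≤ X
    1≤X = 1≤* (ℕ.m^n>0 2 a) 1≤s

    1≤X^ : ∀ k → 1 ℕ.≤ X ℕ.^ k
    1≤X^ zero    = ℕ.≤-refl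
    1≤X^ (suc k) = 1≤* 1≤X (1≤X^ k)

    4^≡2^ : ∀ k → 4 ℕ.^ k ≡ 2 ℕ.^ (2 ℕ.* k)
    4^≡2^ k = ℕ.^-*-assoc 2 2 k

    Z≡ : Z ≡ 2 ℕ.^ (2 ℕ.* (3 ℕ.* g)) ℕ.* X ℕ.^ (3 ℕ.* g)
    Z≡ = trans (*-distrib-^ 4 X (3 ℕ.* g)) (cong (ℕ._* X ℕ.^ (3 ℕ.* g)) (4^≡2^ (3 ℕ.* g)))

    1≤Z : 1 ℕ.≤ Z
    1≤Z = subst (1 ℕ.≤_) (sym Z≡) (1≤* (ℕ.m^n>0 2 (2 ℕ.* (3 ℕ.* g))) (1≤X^ (3 ℕ.* g)))

    1≤P : 1 ℕ.≤ P
    1≤P = ℕ.m^n>0 2 (2 ℕ.* g)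

    ≤B : ∀ {x} → x ℕ.≤ V → x ℕ.≤ B
    ≤B x≤V = ≤*ˡ Z 1≤Z (≤*ˡ P 1≤P x≤V)

    X≤V : X ℕ.≤ V
    X≤V = ≤*ˡ L 1≤L (≤*ˡ g (s≤s z≤n) ℕ.≤-refl)

    1≤V : 1 ℕ.≤ V
    1≤V = ℕ.≤-trans 1≤X X≤V

    s≤V : s ℕ.≤ V
    s≤V = ℕ.≤-trans (≤*ʳ (2 ℕ.^ a) (ℕ.m^n>0 2 a) ℕ.≤-refl) X≤V

    1+n≤2^[1+g] : suc n ℕ.≤ 2 ℕ.^ suc g
    1+n≤2^[1+g] = ℕ.≤-trans (ℕ.+-mono-≤ (ℕ.m^n>0 2 g) n≤2^g)
      (ℕ.+-monoʳ-≤ (2 ℕ.^ g) (ℕ.≤-reflexive (sym (ℕ.+-identityʳ (2 ℕ.^ g)))))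

    1+n≤P : suc n ℕ.≤ P
    1+n≤P = ℕ.≤-trans 1+n≤2^[1+g] (ℕ.^-monoʳ-≤ 2 (ℕ.≤-trans (ℕ.+-monoˡ-≤ g {1} {g} (s≤s z≤n))
      (ℕ.+-monoʳ-≤ g (ℕ.≤-reflexive (sym (ℕ.+-identityʳ g))))))

    m≡14V : m ≡ 14 ℕ.* V
    m≡14V = lem (2 ℕ.^ a) s g L
      where
      lem : ∀ q s g L → 2 ℕ.* q ℕ.* (7 ℕ.* (s ℕ.* (g ℕ.* L))) ≡ 14 ℕ.* (q ℕ.* s ℕ.* g ℕ.* L)
      lem = solve-∀

    1+m≤15V : suc m ℕ.≤ 15 ℕ.* V
    1+m≤15V = ℕ.+-mono-≤ 1≤V (ℕ.≤-reflexive m≡14V)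

    2^d≤4X : 2 ℕ.^ d ℕ.≤ 4 ℕ.* X
    2^d≤4X = begin
      2 ℕ.^ (1 ℕ.+ a ℕ.+ e)             ≡⟨ ℕ.^-distribˡ-+-* 2 (1 ℕ.+ a) e ⟩
      2 ℕ.* 2 ℕ.^ a ℕ.* 2 ℕ.^ e         ≤⟨ ℕ.*-monoʳ-≤ (2 ℕ.* 2 ℕ.^ a) 2^e≤2s ⟩
      2 ℕ.* 2 ℕ.^ a ℕ.* (2 ℕ.* s)       ≡⟨ lem (2 ℕ.^ a) s ⟩
      4 ℕ.* X                           ∎
      where
      open ℕ.≤-Reasoning
      lem : ∀ q s → 2 ℕ.* q ℕ.* (2 ℕ.* s) ≡ 4 ℕ.* (q ℕ.* s)
      lem = solve-∀

    -- The quasi-polynomial exchange: 2 (n + 1) is at most 2^(3g), and (2^(3g))^d = (2^d)^(3g),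
    -- where 2^d is at most 4X.
    K^d≤Z : (2 ℕ.* suc n) ℕ.^ d ℕ.≤ Z
    K^d≤Z = begin
      (2 ℕ.* suc n) ℕ.^ d               ≤⟨ ℕ.^-monoˡ-≤ d (ℕ.*-monoʳ-≤ 2 1+n≤2^[1+g]) ⟩
      (2 ℕ.^ (2 ℕ.+ g)) ℕ.^ d           ≤⟨ ℕ.^-monoˡ-≤ d (ℕ.^-monoʳ-≤ 2 2+g≤3g) ⟩
      (2 ℕ.^ (3 ℕ.* g)) ℕ.^ d           ≡⟨ ℕ.^-*-assoc 2 (3 ℕ.* g) d ⟩
      2 ℕ.^ (3 ℕ.* g ℕ.* d)             ≡⟨ cong (2 ℕ.^_) (ℕ.*-comm (3 ℕ.* g) d) ⟩
      2 ℕ.^ (d ℕ.* (3 ℕ.* g))           ≡⟨ sym (ℕ.^-*-assoc 2 d (3 ℕ.* g)) ⟩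
      (2 ℕ.^ d) ℕ.^ (3 ℕ.* g)           ≤⟨ ℕ.^-monoˡ-≤ (3 ℕ.* g) 2^d≤4X ⟩
      Z                                 ∎
      where
      open ℕ.≤-Reasoning
      2+g≤3g : 2 ℕ.+ g ℕ.≤ 3 ℕ.* g
      2+g≤3g = ℕ.≤-trans (ℕ.m≤m+n (2 ℕ.+ g) (2 ℕ.* j)) (ℕ.≤-reflexive (lem j))
        where
        lem : ∀ j → 2 ℕ.+ suc j ℕ.+ 2 ℕ.* j ≡ 3 ℕ.* suc j
        lem = solve-∀

    linear≤ : 238 ℕ.+ 6 ℕ.* n ℕ.+ 6 ℕ.* s ℕ.+ 21 ℕ.* j ℕ.+ 15 ℕ.* L ℕ.+ 39 ℕ.* a ℕ.+ 15 ℕ.* e ℕ.≤ 355 ℕ.* B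
    linear≤ = ℕ.≤-trans
      (ℕ.+-mono-≤ (ℕ.+-mono-≤ (ℕ.+-mono-≤ (ℕ.+-mono-≤ (ℕ.+-mono-≤ (ℕ.+-mono-≤
        (ℕ.*-monoʳ-≤ 238 (≤B 1≤V)) (ℕ.*-monoʳ-≤ 6 n≤B)) (ℕ.*-monoʳ-≤ 6 (≤B s≤V)))
        (ℕ.*-monoʳ-≤ 21 (≤B j≤V))) (ℕ.*-monoʳ-≤ 15 (≤B (≤*ʳ (X ℕ.* g) (1≤* 1≤X (s≤s z≤n)) ℕ.≤-refl))))
        (ℕ.*-monoʳ-≤ 39 (≤B a≤V))) (ℕ.*-monoʳ-≤ 15 e≤2B))
      (ℕ.≤-reflexive (lem B))
      where
      n≤B : n ℕ.≤ B
      n≤B = ≤*ˡ Z 1≤Z (≤*ʳ V 1≤V (ℕ.≤-trans (ℕ.n≤1+n n) 1+n≤P))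
      j≤V : j ℕ.≤ V
      j≤V = ≤*ˡ L 1≤L (≤*ʳ X 1≤X (ℕ.n≤1+n j))
      a≤V : a ℕ.≤ V
      a≤V = ℕ.≤-trans (≤*ˡ s 1≤s (ℕ.<⇒≤ (n<2^n a))) X≤V
      e≤2B : e ℕ.≤ 2 ℕ.* B
      e≤2B = ℕ.≤-trans (ℕ.<⇒≤ (n<2^n e)) (ℕ.≤-trans 2^e≤2s (ℕ.*-monoʳ-≤ 2 (≤B s≤V)))
      lem : ∀ b → 238 ℕ.* b ℕ.+ 6 ℕ.* b ℕ.+ 6 ℕ.* b ℕ.+ 21 ℕ.* b ℕ.+ 15 ℕ.* b ℕ.+ 39 ℕ.* b
                  ℕ.+ 15 ℕ.* (2 ℕ.* b) ≡ 355 ℕ.* b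
      lem = solve-∀

    sampling≤ : m ℕ.* (n ℕ.+ 6) ℕ.≤ 84 ℕ.* B
    sampling≤ = begin
      m ℕ.* (n ℕ.+ 6)                ≡⟨ cong (ℕ._* (n ℕ.+ 6)) m≡14V ⟩
      14 ℕ.* V ℕ.* (n ℕ.+ 6)         ≤⟨ ℕ.*-monoʳ-≤ (14 ℕ.* V) (ℕ.m≤m+n (n ℕ.+ 6) (5 ℕ.* n)) ⟩
      14 ℕ.* V ℕ.* (n ℕ.+ 6 ℕ.+ 5 ℕ.* n) ≡⟨ lem V n ⟩
      84 ℕ.* (V ℕ.* suc n)           ≤⟨ ℕ.*-monoʳ-≤ 84 (≤*ˡ Z 1≤Z (ℕ.*-monoʳ-≤ V 1+n≤P)) ⟩
      84 ℕ.* B                       ∎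
      where
      open ℕ.≤-Reasoning
      lem : ∀ v n → 14 ℕ.* v ℕ.* (n ℕ.+ 6 ℕ.+ 5 ℕ.* n) ≡ 84 ℕ.* (v ℕ.* suc n)
      lem = solve-∀

    learning≤ : learn-time n m d ℕ.≤ 1005 ℕ.* B
    learning≤ = begin
      learn-time n m d
        ≤⟨ learn-time-≤ n m d ⟩
      67 ℕ.* (suc m ℕ.* suc n) ℕ.* (2 ℕ.* suc n) ℕ.^ d
        ≤⟨ ℕ.*-mono-≤ (ℕ.*-monoʳ-≤ 67 (ℕ.*-mono-≤ 1+m≤15V 1+n≤P)) K^d≤Z ⟩
      67 ℕ.* (15 ℕ.* V ℕ.* P) ℕ.* Z
        ≡⟨ lem V P Z ⟩
      1005 ℕ.* B ∎
      where
      open ℕ.≤-Reasoning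
      lem : ∀ v p z → 67 ℕ.* (15 ℕ.* v ℕ.* p) ℕ.* z ≡ 1005 ℕ.* (v ℕ.* p ℕ.* z)
      lem = solve-∀

    -- The stray factors are absorbed into the powers: g into 2^g, which raises the exponent of 2
    -- from 8g to 9g, and X into X^g.
    B≤ : B ℕ.≤ X ℕ.^ (4 ℕ.* g) ℕ.* 2 ℕ.^ (9 ℕ.* g) ℕ.* L
    B≤ = begin
      X ℕ.* g ℕ.* L ℕ.* P ℕ.* Z
        ≡⟨ cong (X ℕ.* g ℕ.* L ℕ.* P ℕ.*_) Z≡ ⟩
      X ℕ.* g ℕ.* L ℕ.* 2 ℕ.^ (2 ℕ.* g) ℕ.* (2 ℕ.^ (2 ℕ.* (3 ℕ.* g)) ℕ.* X ℕ.^ (3 ℕ.* g))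
        ≡⟨ lem X g L (2 ℕ.^ (2 ℕ.* g)) (2 ℕ.^ (2 ℕ.* (3 ℕ.* g))) (X ℕ.^ (3 ℕ.* g)) ⟩
      X ℕ.^ suc (3 ℕ.* g) ℕ.* (g ℕ.* (2 ℕ.^ (2 ℕ.* g) ℕ.* 2 ℕ.^ (2 ℕ.* (3 ℕ.* g)))) ℕ.* L
        ≤⟨ ℕ.*-monoˡ-≤ L (ℕ.*-mono-≤ X^≤ 2^≤) ⟩
      X ℕ.^ (4 ℕ.* g) ℕ.* 2 ℕ.^ (9 ℕ.* g) ℕ.* L ∎
      where
      open ℕ.≤-Reasoning
      lem : ∀ x g l p q y → x ℕ.* g ℕ.* l ℕ.* p ℕ.* (q ℕ.* y) ≡ x ℕ.* y ℕ.* (g ℕ.* (p ℕ.* q)) ℕ.* l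
      lem = solve-∀
      X^≤ : X ℕ.^ suc (3 ℕ.* g) ℕ.≤ X ℕ.^ (4 ℕ.* g)
      X^≤ = ℕ.^-monoʳ-≤ X {{ℕ.>-nonZero 1≤X}} (ℕ.+-monoˡ-≤ (3 ℕ.* g) {1} {g} (s≤s z≤n))
      exponents : ∀ g → g ℕ.+ (2 ℕ.* g ℕ.+ 2 ℕ.* (3 ℕ.* g)) ≡ 9 ℕ.* g
      exponents = solve-∀
      2^≤ : g ℕ.* (2 ℕ.^ (2 ℕ.* g) ℕ.* 2 ℕ.^ (2 ℕ.* (3 ℕ.* g))) ℕ.≤ 2 ℕ.^ (9 ℕ.* g)
      2^≤ = begin
        g ℕ.* (2 ℕ.^ (2 ℕ.* g) ℕ.* 2 ℕ.^ (2 ℕ.* (3 ℕ.* g)))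
          ≡⟨ cong (g ℕ.*_) (sym (ℕ.^-distribˡ-+-* 2 (2 ℕ.* g) (2 ℕ.* (3 ℕ.* g)))) ⟩
        g ℕ.* 2 ℕ.^ (2 ℕ.* g ℕ.+ 2 ℕ.* (3 ℕ.* g))
          ≤⟨ ℕ.*-monoˡ-≤ _ (ℕ.<⇒≤ (n<2^n g)) ⟩
        2 ℕ.^ g ℕ.* 2 ℕ.^ (2 ℕ.* g ℕ.+ 2 ℕ.* (3 ℕ.* g))
          ≡⟨ sym (ℕ.^-distribˡ-+-* 2 g (2 ℕ.* g ℕ.+ 2 ℕ.* (3 ℕ.* g))) ⟩
        2 ℕ.^ (g ℕ.+ (2 ℕ.* g ℕ.+ 2 ℕ.* (3 ℕ.* g)))
          ≡⟨ cong (2 ℕ.^_) (exponents g) ⟩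
        2 ℕ.^ (9 ℕ.* g) ∎

  total-time-≤ :
    238 ℕ.+ 6 ℕ.* n ℕ.+ 6 ℕ.* s ℕ.+ 21 ℕ.* j ℕ.+ 15 ℕ.* L ℕ.+ 39 ℕ.* a ℕ.+ 15 ℕ.* e
      ℕ.+ 2 ℕ.^ (1 ℕ.+ a) ℕ.* (7 ℕ.* (s ℕ.* (suc j ℕ.* L))) ℕ.* (n ℕ.+ 6)
      ℕ.+ learn-time n (2 ℕ.^ (1 ℕ.+ a) ℕ.* (7 ℕ.* (s ℕ.* (suc j ℕ.* L)))) (1 ℕ.+ a ℕ.+ e)
    ℕ.≤ 1444 ℕ.* ((2 ℕ.^ a ℕ.* s) ℕ.^ (4 ℕ.* suc j) ℕ.* 2 ℕ.^ (9 ℕ.* suc j) ℕ.* L)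
  total-time-≤ = ℕ.≤-trans (ℕ.+-mono-≤ (ℕ.+-mono-≤ linear≤ sampling≤) learning≤)
    (ℕ.≤-trans (ℕ.≤-reflexive (lem B)) (ℕ.*-monoʳ-≤ 1444 B≤))
    where
    lem : ∀ b → 355 ℕ.* b ℕ.+ 84 ℕ.* b ℕ.+ 1005 ℕ.* b ≡ 1444 ℕ.* b
    lem = solve-∀

-- The probability of success

pass : ∀ {n} → (Point n → Bool) → ℕ → DT n → Point n → ℚ
pass f d t x = bitℚ (not (wrong d t x (f x)))

guard : ∀ {P : Set} → Dec P → ℚ → ℚ
guard (yes _) q = q
guard (no _)  q = 0ℚ

-- Trees which pass with probability greater than p get weight 0, so that the expectation
-- is at most p for every tree.
charge : ∀ {n} → (Point n → Bool) → ℕ → ℚ → List (DT n) → Point n → ℚ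
charge f d p []      x = 0ℚ
charge f d p (t ∷ _) x = guard (𝔼 (pass f d t) ℚ.≤? p) (pass f d t x)

module _ {n : ℕ} (f : Point n → Bool) (d : ℕ) (p : ℚ) where

  0≤charge : ∀ ts x → 0ℚ ≤ charge f d p ts x
  0≤charge []      x = ℚ.≤-refl
  0≤charge (t ∷ _) x = go (𝔼 (pass f d t) ℚ.≤? p)
    where
    go : ∀ D → 0ℚ ≤ guard D (pass f d t x)
    go (yes _) = 0≤bitℚ (not (wrong d t x (f x)))
    go (no _)  = ℚ.≤-refl

  𝔼-charge : 0ℚ ≤ p → ∀ ts → 𝔼 (charge f d p ts) ≤ p
  𝔼-charge 0≤p []      = ℚ.≤-trans (ℚ.≤-reflexive (𝔼-const {n} 0ℚ)) 0≤p
  𝔼-charge 0≤p (t ∷ _) = go (𝔼 (pass f d t) ℚ.≤? p)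
    where
    go : (D : Dec (𝔼 (pass f d t) ≤ p)) → 𝔼 (λ x → guard D (pass f d t x)) ≤ p
    go (yes E≤p) = E≤p
    go (no _)    = ℚ.≤-trans (ℚ.≤-reflexive (𝔼-const {n} 0ℚ)) 0≤p

  charge-consistent : ∀ t ts xs → 𝔼 (pass f d t) ≤ p →
    (∀ {x} → x ∈ xs → wrong d t x (f x) ≡ false) → ∏ (charge f d p (t ∷ ts)) xs ≡ 1ℚ
  charge-consistent t ts [] E≤p ok = refl
  charge-consistent t ts (x ∷ xs) E≤p ok = trans
    (cong₂ _*_ (go (𝔼 (pass f d t) ℚ.≤? p)) (charge-consistent t ts xs E≤p (λ x∈ → ok (there x∈))))
    (ℚ.*-identityˡ 1ℚ)
    where
    go : (D : Dec (𝔼 (pass f d t) ≤ p)) → guard D (pass f d t x) ≡ 1ℚ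
    go (yes _)  = cong (λ b → bitℚ (not b)) (ok (here refl))
    go (no E≰p) = ⊥-elim (E≰p E≤p)

-- A result that is not good has size at most s, so its error exceeds ε and its one-tree stack is
-- among the enumerated ones. Its pass probability is at most 1 - ν, so `charge` does not suppress
-- it; it passes at every sample point, so its product is 1, as the union bound requires.
learner-succeeds : ∀ {n} {f : Point n → Bool} {s d ε ν c m r} →
  f ∈DT^ s → fromℕ s * ½ ^ d ≤ ν → ν + ν ≤ ε → 0ℚ ≤ 1ℚ - ν →
  Draws c m (λ xs h → h ≡ proj₂ (learn (allFin n) s d (label f xs))) r →
  1ℚ ≤ Pr r (good? f s ε) + (1ℚ - ν) ^ m * fromℕ ((3 ℕ.+ n) ℕ.^ (2 ℕ.* s))
learner-succeeds {n} {f} {s} {d} {ε} {ν} {m = m} {r} (t , size≤s , t≗f) s≤ν 2ν≤ε 0≤p draws = ℚ.≤-trans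
  (union-bound (forests (2 ℕ.* s)) (charge f d p) p 0≤p (0≤charge f d p) (𝔼-charge f d p 0≤p)
    (good? f s ε) draws (λ _ → 1ℚ) (λ _ → 0≤1) failure)
  (ℚ.≤-reflexive (cong (λ q → Pr r (good? f s ε) + p ^ m * q)
    (trans (∑-1 (forests (2 ℕ.* s))) (cong fromℕ (length-forests (2 ℕ.* s))))))
  where
  p : ℚ
  p = 1ℚ - ν
  failure : ∀ xs h → h ≡ proj₂ (learn (allFin n) s d (label f xs)) → ¬ Good f s ε h →
    ∃[ ts ] ts ∈ forests (2 ℕ.* s) × 1ℚ ≤ 1ℚ * ∏ (charge f d p ts) xs
  failure xs h refl bad = h ∷ [] , small-∈ h size-h≤s , ℚ.≤-reflexive (sym (trans (ℚ.*-identityˡ _)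
    (charge-consistent f d p h [] xs
      (Pr-not-wrong {d = d} {h} f (Sound.read-once sound) size-h≤s s≤ν 2ν≤ε (λ err → bad (size-h≤s , err)))
      (λ x∈ → Sound.consistent sound k≤s (∈.∈-map⁺ (λ x → x , f x) x∈)))))
    where
    S = label f xs
    sound = learn-sound (allFin n) s d S
    fits : Fits t S
    fits e∈ with ∈.∈-map⁻ (λ x → x , f x) e∈
    ... | x , _ , refl = t≗f x
    -- The target fits its own sample. This is where membership in the class enters, and it unlocks
    -- the conditional fields of `Sound`.
    k≤s : proj₁ (learn (allFin n) s d S) ℕ.≤ s
    k≤s = ℕ.≤-trans (learn-≤ ∈.∈-allFin d t fits) size≤s
    size-h≤s : size h ℕ.≤ s
    size-h≤s = ℕ.≤-trans (Sound.bounded sound k≤s) k≤s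

½^-antitone : ∀ k l → ½ ^ (k ℕ.+ l) ≤ ½ ^ k
½^-antitone k l = begin
  ½ ^ (k ℕ.+ l)   ≡⟨ ^-+ ½ k l ⟩
  ½ ^ k * ½ ^ l   ≤⟨ ℚ.*-monoˡ-≤-nonNeg (½ ^ k) {{ℚ.nonNegative (^-nonneg k 0≤½)}} (½^≤1 l) ⟩
  ½ ^ k * 1ℚ      ≡⟨ ℚ.*-identityʳ (½ ^ k) ⟩
  ½ ^ k           ∎
  where
  open ℚ.≤-Reasoning
  ½^≤1 : ∀ l → ½ ^ l ≤ 1ℚ
  ½^≤1 zero    = ℚ.≤-refl
  ½^≤1 (suc l) = *-mono-≤ 0≤½ (^-nonneg l 0≤½) (ℚ.≤ᵇ⇒≤ {½} {1ℚ} tt) (½^≤1 l)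

-- A division-free substitute for the bound of (1 - ν)^k by an exponential. The step uses (1 - ν)(1
-- + (k + 1) ν) = 1 + k ν - (k + 1) ν².
bernoulli : ∀ ν → 0ℚ ≤ ν → 0ℚ ≤ 1ℚ - ν → ∀ k → (1ℚ - ν) ^ k * (1ℚ + fromℕ k * ν) ≤ 1ℚ
bernoulli ν 0≤ν 0≤p zero = ℚ.≤-reflexive (trans (ℚ.*-identityˡ _)
  (trans (cong (λ q → 1ℚ + q) (ℚ.*-zeroˡ ν)) (ℚ.+-identityʳ 1ℚ)))
bernoulli ν 0≤ν 0≤p (suc k) = begin
  p * p ^ k * (1ℚ + fromℕ (suc k) * ν)
    ≡⟨ cong (λ q → p * p ^ k * (1ℚ + q * ν)) (fromℕ-+ 1 k) ⟩
  p * p ^ k * (1ℚ + (1ℚ + fromℕ k) * ν)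
    ≡⟨ lem₁ ν (p ^ k) (fromℕ k) ⟩
  p ^ k * (1ℚ + fromℕ k * ν) - p ^ k * ((1ℚ + fromℕ k) * (ν * ν))
    ≤⟨ ℚ.+-monoʳ-≤ (p ^ k * (1ℚ + fromℕ k * ν)) (ℚ.neg-antimono-≤
         (*-nonneg (^-nonneg k 0≤p) (*-nonneg (ℚ.+-mono-≤ 0≤1 (0≤fromℕ k)) (*-nonneg 0≤ν 0≤ν)))) ⟩
  p ^ k * (1ℚ + fromℕ k * ν) + 0ℚ
    ≡⟨ ℚ.+-identityʳ _ ⟩
  p ^ k * (1ℚ + fromℕ k * ν)
    ≤⟨ bernoulli ν 0≤ν 0≤p k ⟩
  1ℚ ∎
  where
  open ℚ.≤-Reasoning
  p : ℚ
  p = 1ℚ - ν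
  lem₁ : ∀ v q k → (1ℚ - v) * q * (1ℚ + (1ℚ + k) * v)
                 ≡ q * (1ℚ + k * v) - q * ((1ℚ + k) * (v * v))
  lem₁ = Ring.solve-∀ ℚ-ring

0≤1-½^ : ∀ b → 0ℚ ≤ 1ℚ - ½ ^ b
0≤1-½^ b = ℚ.≤-trans (ℚ.≤-reflexive (sym (ℚ.+-inverseʳ (½ ^ b)))) (ℚ.+-monoˡ-≤ (- (½ ^ b)) (½^-antitone 0 b))

-- For k = 1/ν the second factor in `bernoulli` is 2, so a block of 1/ν draws halves the survival
-- probability.
[1-½^b]^2^b≤½ : ∀ b → (1ℚ - ½ ^ b) ^ (2 ℕ.^ b) ≤ ½
[1-½^b]^2^b≤½ b = begin
  q              ≡⟨ sym (average q) ⟩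
  ½ * (q + q)    ≡⟨ cong (λ x → ½ * x) (sym two) ⟩
  ½ * (q * (1ℚ + fromℕ (2 ℕ.^ b) * ½ ^ b))
    ≤⟨ ℚ.*-monoˡ-≤-nonNeg ½ (bernoulli (½ ^ b) (^-nonneg b 0≤½) (0≤1-½^ b) (2 ℕ.^ b)) ⟩
  ½ * 1ℚ         ≡⟨ ℚ.*-identityʳ ½ ⟩
  ½              ∎
  where
  open ℚ.≤-Reasoning
  q : ℚ
  q = (1ℚ - ½ ^ b) ^ (2 ℕ.^ b)
  two : q * (1ℚ + fromℕ (2 ℕ.^ b) * ½ ^ b) ≡ q + q
  two = trans (cong (λ x → q * (1ℚ + x)) (2^k*½^k≡1 b)) (lem q)
    where
    lem : ∀ q → q * (1ℚ + 1ℚ) ≡ q + q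
    lem = Ring.solve-∀ ℚ-ring

-- Since 3 + n ≤ 2^(3g), programs of 2s instructions number at most 2^(6sg). Of the 7X halvings, 6X
-- outweigh this count and the remaining X ≥ L give the confidence.
failure-probability : ∀ b n s g L → 1 ℕ.≤ s → n ℕ.≤ 2 ℕ.^ g → 1 ℕ.≤ g → 1 ℕ.≤ L →
  (1ℚ - ½ ^ b) ^ (2 ℕ.^ b ℕ.* (7 ℕ.* (s ℕ.* (g ℕ.* L)))) * fromℕ ((3 ℕ.+ n) ℕ.^ (2 ℕ.* s)) ≤ ½ ^ L
failure-probability b n s g L 1≤s n≤2^g 1≤g 1≤L = begin
  p ^ (2 ℕ.^ b ℕ.* M) * fromℕ ((3 ℕ.+ n) ℕ.^ (2 ℕ.* s))
    ≤⟨ *-mono-≤ (^-nonneg (2 ℕ.^ b ℕ.* M) (0≤1-½^ b)) (0≤fromℕ ((3 ℕ.+ n) ℕ.^ (2 ℕ.* s)))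
         p^≤ (fromℕ-mono count) ⟩
  ½ ^ M * fromℕ (2 ℕ.^ (6 ℕ.* X))
    ≡⟨ cong (_* fromℕ (2 ℕ.^ (6 ℕ.* X))) (trans (cong (½ ^_) (lem₁ X)) (^-+ ½ X (6 ℕ.* X))) ⟩
  ½ ^ X * ½ ^ (6 ℕ.* X) * fromℕ (2 ℕ.^ (6 ℕ.* X))
    ≡⟨ lem₂ (½ ^ X) (½ ^ (6 ℕ.* X)) (fromℕ (2 ℕ.^ (6 ℕ.* X))) ⟩
  ½ ^ X * (fromℕ (2 ℕ.^ (6 ℕ.* X)) * ½ ^ (6 ℕ.* X))
    ≡⟨ cong (λ q → ½ ^ X * q) (2^k*½^k≡1 (6 ℕ.* X)) ⟩
  ½ ^ X * 1ℚ
    ≡⟨ ℚ.*-identityʳ (½ ^ X) ⟩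
  ½ ^ X
    ≡⟨ cong (½ ^_) (sym (ℕ.m+[n∸m]≡n L≤X)) ⟩
  ½ ^ (L ℕ.+ (X ℕ.∸ L))
    ≤⟨ ½^-antitone L (X ℕ.∸ L) ⟩
  ½ ^ L ∎
  where
  open ℚ.≤-Reasoning
  p : ℚ
  p = 1ℚ - ½ ^ b
  X M : ℕ
  X = s ℕ.* (g ℕ.* L)
  M = 7 ℕ.* X
  lem₁ : ∀ x → 7 ℕ.* x ≡ x ℕ.+ 6 ℕ.* x
  lem₁ = solve-∀
  lem₂ : ∀ a b c → a * b * c ≡ a * (c * b)
  lem₂ = Ring.solve-∀ ℚ-ring
  p^≤ : p ^ (2 ℕ.^ b ℕ.* M) ≤ ½ ^ M
  p^≤ = ℚ.≤-trans (ℚ.≤-reflexive (trans (cong (p ^_) (ℕ.*-comm (2 ℕ.^ b) M)) (^-* p M (2 ℕ.^ b))))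
    (^-mono-≤ M (^-nonneg (2 ℕ.^ b) (0≤1-½^ b)) ([1-½^b]^2^b≤½ b))
  L≤X : L ℕ.≤ X
  L≤X = ℕ.≤-trans (ℕ.≤-reflexive (lem L)) (ℕ.*-mono-≤ 1≤s (ℕ.*-monoˡ-≤ L 1≤g))
    where
    lem : ∀ l → l ≡ 1 ℕ.* (1 ℕ.* l)
    lem = solve-∀
  count-base : 3 ℕ.+ n ℕ.≤ 2 ℕ.^ (3 ℕ.* g)
  count-base = ≤-base g n n≤2^g 1≤g
    where
    ≤-base : ∀ g n → n ℕ.≤ 2 ℕ.^ g → 1 ℕ.≤ g → 3 ℕ.+ n ℕ.≤ 2 ℕ.^ (3 ℕ.* g)
    ≤-base (suc h) n n≤ _ = ℕR.begin
      3 ℕ.+ n                                 ℕR.≤⟨ ℕ.+-mono-≤ (ℕ.*-monoʳ-≤ 3 (ℕ.m^n>0 2 (suc h))) n≤ ⟩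
      3 ℕ.* 2 ℕ.^ suc h ℕ.+ 2 ℕ.^ suc h       ℕR.≡⟨ lem (2 ℕ.^ h) ⟩
      2 ℕ.^ 3 ℕ.* 2 ℕ.^ h                     ℕR.≡⟨ sym (ℕ.^-distribˡ-+-* 2 3 h) ⟩
      2 ℕ.^ (3 ℕ.+ h)                         ℕR.≤⟨ ℕ.^-monoʳ-≤ 2 (ℕ.≤-trans (ℕ.m≤m+n (3 ℕ.+ h) (2 ℕ.* h)) (ℕ.≤-reflexive (lem′ h))) ⟩
      2 ℕ.^ (3 ℕ.* suc h)                     ℕR.∎
      where
      module ℕR = ℕ.≤-Reasoning
      lem : ∀ p → 3 ℕ.* (2 ℕ.* p) ℕ.+ 2 ℕ.* p ≡ 8 ℕ.* p
      lem = solve-∀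
      lem′ : ∀ h → 3 ℕ.+ h ℕ.+ 2 ℕ.* h ≡ 3 ℕ.* suc h
      lem′ = solve-∀
  count : (3 ℕ.+ n) ℕ.^ (2 ℕ.* s) ℕ.≤ 2 ℕ.^ (6 ℕ.* X)
  count = ℕ.≤-trans (ℕ.^-monoˡ-≤ (2 ℕ.* s) count-base)
    (ℕ.≤-trans (ℕ.≤-reflexive (ℕ.^-*-assoc 2 (3 ℕ.* g) (2 ℕ.* s)))
      (ℕ.^-monoʳ-≤ 2 (ℕ.≤-trans (ℕ.≤-reflexive (lem s g))
        (ℕ.*-monoʳ-≤ 6 (ℕ.*-monoʳ-≤ s (ℕ.*-monoʳ-≤ g 1≤L))))))
    where
    lem : ∀ s g → 3 ℕ.* g ℕ.* (2 ℕ.* s) ≡ 6 ℕ.* (s ℕ.* (g ℕ.* 1))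
    lem = solve-∀

-- Numerators and denominators

fromℕ-pos : ∀ k → .{{ℕ.NonZero k}} → Positive (fromℕ k)
fromℕ-pos k = ℚ.normalize-pos k 1

denominator-* : ∀ ε .{{_ : Positive ε}} → fromℕ (↧ₙ ε) * ε ≡ fromℕ ∣ ↥ ε ∣
denominator-* ε@(mkℚ +[1+ x ] y _) = ℚ.toℚᵘ-injective
  (ℚᵘ.≃-trans (ℚ.toℚᵘ-homo-* (fromℕ (suc y)) ε)
  (ℚᵘ.≃-trans (ℚᵘ.*-congʳ {mkℚᵘ +[1+ x ] y} (ℚ.toℚᵘ-fromℚᵘ (mkℚᵘ (+ suc y) 0)))
  (ℚᵘ.≃-trans (*≡* (lem (+ suc y) +[1+ x ])) (ℚᵘ.≃-sym (ℚ.toℚᵘ-fromℚᵘ (mkℚᵘ (+ suc x) 0))))))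
  where
  lem : ∀ a b → a ℤ.* b ℤ.* ℤ.1ℤ ≡ b ℤ.* (ℤ.1ℤ ℤ.* a)
  lem = ℤ-Solver.solve-∀

inv-* : ∀ ε .{{_ : Positive ε}} → inv ε * ε ≡ 1ℚ
inv-* ε = ℚ.*-inverseˡ ε {{ℚ.pos⇒nonZero ε}}

0<numerator : ∀ ε .{{_ : Positive ε}} → 1 ℕ.≤ ∣ ↥ ε ∣
0<numerator (mkℚ +[1+ _ ] _ _) = s≤s z≤n

numerator<denominator : ∀ ε .{{_ : Positive ε}} → ε < 1ℚ → ∣ ↥ ε ∣ ℕ.< ↧ₙ ε
numerator<denominator (mkℚ +[1+ x ] y _) (ℚ.*<* lt) =
  ℤ.drop‿+<+ (subst₂ ℤ._<_ (ℤ.*-identityʳ +[1+ x ]) (ℤ.*-identityˡ (+ suc y)) lt)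

½^≤ : ∀ ε .{{_ : Positive ε}} k → ↧ₙ ε ℕ.≤ 2 ℕ.^ k ℕ.* ∣ ↥ ε ∣ → ½ ^ k ≤ ε
½^≤ ε@(mkℚ _ y _) k den≤ = ℚ.*-cancelˡ-≤-pos (fromℕ (suc y)) {{fromℕ-pos (suc y)}} (begin
  fromℕ (↧ₙ ε) * ½ ^ k
    ≤⟨ ℚ.*-monoʳ-≤-nonNeg (½ ^ k) {{ℚ.nonNegative (^-nonneg k 0≤½)}} (fromℕ-mono den≤) ⟩
  fromℕ (2 ℕ.^ k ℕ.* ∣ ↥ ε ∣) * ½ ^ k
    ≡⟨ cong (_* ½ ^ k) (fromℕ-* (2 ℕ.^ k) ∣ ↥ ε ∣) ⟩
  fromℕ (2 ℕ.^ k) * fromℕ ∣ ↥ ε ∣ * ½ ^ k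
    ≡⟨ lem (fromℕ (2 ℕ.^ k)) (fromℕ ∣ ↥ ε ∣) (½ ^ k) ⟩
  fromℕ (2 ℕ.^ k) * ½ ^ k * fromℕ ∣ ↥ ε ∣
    ≡⟨ cong (_* fromℕ ∣ ↥ ε ∣) (2^k*½^k≡1 k) ⟩
  1ℚ * fromℕ ∣ ↥ ε ∣
    ≡⟨ ℚ.*-identityˡ (fromℕ ∣ ↥ ε ∣) ⟩
  fromℕ ∣ ↥ ε ∣
    ≡⟨ sym (denominator-* ε) ⟩
  fromℕ (↧ₙ ε) * ε ∎)
  where
  open ℚ.≤-Reasoning
  lem : ∀ a b c → a * b * c ≡ a * c * b
  lem = Ring.solve-∀ ℚ-ring

≤*inv : ∀ ε .{{_ : Positive ε}} k l → k ℕ.* ∣ ↥ ε ∣ ℕ.≤ l ℕ.* ↧ₙ ε → fromℕ k ≤ fromℕ l * inv ε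
≤*inv ε@(mkℚ +[1+ x ] y _) k l k≤ = ℚ.*-cancelʳ-≤-pos (fromℕ (suc x)) {{fromℕ-pos (suc x)}} (begin
  fromℕ k * fromℕ (suc x)                ≡⟨ sym (fromℕ-* k (suc x)) ⟩
  fromℕ (k ℕ.* suc x)                    ≤⟨ fromℕ-mono k≤ ⟩
  fromℕ (l ℕ.* suc y)                    ≡⟨ fromℕ-* l (suc y) ⟩
  fromℕ l * fromℕ (suc y)                ≡⟨ sym (ℚ.*-identityʳ _) ⟩
  fromℕ l * fromℕ (suc y) * 1ℚ           ≡⟨ cong (λ q → fromℕ l * fromℕ (suc y) * q) (sym (inv-* ε)) ⟩
  fromℕ l * fromℕ (suc y) * (inv ε * ε)  ≡⟨ lem (fromℕ l) (fromℕ (suc y)) (inv ε) ε ⟩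
  fromℕ l * inv ε * (fromℕ (suc y) * ε)  ≡⟨ cong (λ q → fromℕ l * inv ε * q) (denominator-* ε) ⟩
  fromℕ l * inv ε * fromℕ (suc x)        ∎)
  where
  open ℚ.≤-Reasoning
  lem : ∀ a b c d → a * b * (c * d) ≡ a * c * (b * d)
  lem = Ring.solve-∀ ℚ-ring

denominator≤ceiling : ∀ ε .{{_ : Positive ε}} → ↧ₙ ε ℕ.≤ ∣ ceiling (inv ε) ∣ ℕ.* ∣ ↥ ε ∣
-- `ceiling` is the negated floor of the negation, so the claim is about dividing minus the
-- denominator by the numerator; the quotient must be negative.
denominator≤ceiling (mkℚ +[1+ x ] y _) = go (-[1+ y ] ℤ./ +[1+ x ]) (ℤ.[n/d]*d≤n -[1+ y ] +[1+ x ])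
  where
  go : ∀ q → q ℤ.* +[1+ x ] ℤ.≤ -[1+ y ] → suc y ℕ.≤ ∣ ℤ.- q ∣ ℕ.* suc x
  go (+ zero)  ()
  go +[1+ k ] ()
  go -[1+ k ]  (ℤ.-≤- le) = s≤s le

confidence≤lg1/ : ∀ δ .{{_ : Positive δ}} → doublings (↧ₙ δ) ∣ ↥ δ ∣ (↧ₙ δ) ℕ.≤ lg1/ δ
confidence≤lg1/ δ = pred<⇒≤ λ r eq → 2^k<n⇒k<⌈log₂n⌉ (ℕ.*-cancelʳ-< _ (2 ℕ.^ r) ∣ ceiling (inv δ) ∣
  (ℕ.<-≤-trans (doublings-least (↧ₙ δ) ∣ ↥ δ ∣ (↧ₙ δ) r eq) (denominator≤ceiling δ)))

-- The base (s/ε) lg n of the stated bound may lie below 2, so powers 2^O(G) have to be absorbed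
-- into G^O(G). At G = 1 this costs the factor 2.
2^≤2*^ : ∀ k → 1 ℕ.≤ k → 2 ℕ.^ k ℕ.≤ 2 ℕ.* k ℕ.^ k
2^≤2*^ 1               _ = ℕ.≤-refl
2^≤2*^ k@(suc (suc _)) _ = ℕ.≤-trans (ℕ.^-monoˡ-≤ k {2} {k} (s≤s (s≤s z≤n))) (ℕ.m≤m+n (k ℕ.^ k) _)

1≤^ : ∀ {p} k → 1ℚ ≤ p → 1ℚ ≤ p ^ k
1≤^ zero    1≤p = ℚ.≤-refl
1≤^ (suc k) 1≤p = *-mono-≤ 0≤1 0≤1 1≤p (1≤^ k 1≤p)

-- X ≤ 2σ contributes 2^(4G) to the 2^(9G) already present, hence the exponent 13G. Absorbing
-- 2^(13G) into G^(13G) leaves the constant 2^13, and σ^(4G) may be raised to σ^(13G) as 1 ≤ σ.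
power-bound : ∀ X G L σ → 1 ℕ.≤ G → 1ℚ ≤ σ → fromℕ X ≤ fromℕ 2 * σ →
  fromℕ (X ℕ.^ (4 ℕ.* G) ℕ.* 2 ℕ.^ (9 ℕ.* G) ℕ.* L)
    ≤ fromℕ (2 ℕ.^ 13) * ((σ * fromℕ G) ^ (13 ℕ.* G) * fromℕ L)
power-bound X G L σ 1≤G 1≤σ X≤2σ = begin
  fromℕ (X ℕ.^ (4 ℕ.* G) ℕ.* 2 ℕ.^ (9 ℕ.* G) ℕ.* L)
    ≡⟨ trans (fromℕ-* (X ℕ.^ (4 ℕ.* G) ℕ.* 2 ℕ.^ (9 ℕ.* G)) L) (cong (_* l)
         (trans (fromℕ-* (X ℕ.^ (4 ℕ.* G)) (2 ℕ.^ (9 ℕ.* G)))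
                (cong₂ _*_ (fromℕ-^ X (4 ℕ.* G)) (fromℕ-^ 2 (9 ℕ.* G))))) ⟩
  fromℕ X ^ (4 ℕ.* G) * t ^ (9 ℕ.* G) * l
    ≤⟨ *l (ℚ.*-monoʳ-≤-nonNeg (t ^ (9 ℕ.* G)) {{ℚ.nonNegative (^-nonneg (9 ℕ.* G) 0≤t)}}
         (^-mono-≤ (4 ℕ.* G) (0≤fromℕ X) X≤2σ)) ⟩
  (t * σ) ^ (4 ℕ.* G) * t ^ (9 ℕ.* G) * l
    ≡⟨ cong (λ q → q * t ^ (9 ℕ.* G) * l) (*-^ t σ (4 ℕ.* G)) ⟩
  t ^ (4 ℕ.* G) * σ ^ (4 ℕ.* G) * t ^ (9 ℕ.* G) * l
    ≡⟨ cong (_* l) (lem₁ (t ^ (4 ℕ.* G)) (σ ^ (4 ℕ.* G)) (t ^ (9 ℕ.* G))) ⟩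
  t ^ (4 ℕ.* G) * t ^ (9 ℕ.* G) * σ ^ (4 ℕ.* G) * l
    ≡⟨ cong (λ q → q * σ ^ (4 ℕ.* G) * l) (sym (^-+ t (4 ℕ.* G) (9 ℕ.* G))) ⟩
  t ^ (4 ℕ.* G ℕ.+ 9 ℕ.* G) * σ ^ (4 ℕ.* G) * l
    ≡⟨ cong (λ k → t ^ k * σ ^ (4 ℕ.* G) * l) (sym (ℕ.*-distribʳ-+ G 4 9)) ⟩
  t ^ (13 ℕ.* G) * σ ^ (4 ℕ.* G) * l
    ≤⟨ *l (*-mono-≤ (^-nonneg (13 ℕ.* G) 0≤t) (^-nonneg (4 ℕ.* G) 0≤σ) t^≤ σ^≤) ⟩
  t ^ 13 * γ ^ (13 ℕ.* G) * σ ^ (13 ℕ.* G) * l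
    ≡⟨ cong₂ (λ p q → p * q) (trans (ℚ.*-assoc (t ^ 13) (γ ^ (13 ℕ.* G)) (σ ^ (13 ℕ.* G)))
         (cong₂ _*_ (sym (fromℕ-^ 2 13)) (trans (ℚ.*-comm (γ ^ (13 ℕ.* G)) (σ ^ (13 ℕ.* G)))
           (sym (*-^ σ γ (13 ℕ.* G)))))) refl ⟩
  fromℕ (2 ℕ.^ 13) * (σ * γ) ^ (13 ℕ.* G) * l
    ≡⟨ ℚ.*-assoc (fromℕ (2 ℕ.^ 13)) ((σ * γ) ^ (13 ℕ.* G)) l ⟩
  fromℕ (2 ℕ.^ 13) * ((σ * γ) ^ (13 ℕ.* G) * l) ∎
  where
  open ℚ.≤-Reasoning
  t γ l : ℚ
  t = fromℕ 2
  γ = fromℕ G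
  l = fromℕ L
  0≤t : 0ℚ ≤ t
  0≤t = 0≤fromℕ 2
  0≤σ : 0ℚ ≤ σ
  0≤σ = ℚ.≤-trans 0≤1 1≤σ
  *l : ∀ {p q} → p ≤ q → p * l ≤ q * l
  *l = ℚ.*-monoʳ-≤-nonNeg l {{ℚ.nonNegative (0≤fromℕ L)}}
  lem₁ : ∀ a b c → a * b * c ≡ a * c * b
  lem₁ = Ring.solve-∀ ℚ-ring
  t^≤ : t ^ (13 ℕ.* G) ≤ t ^ 13 * γ ^ (13 ℕ.* G)
  t^≤ = begin
    t ^ (13 ℕ.* G)          ≡⟨ ^-* t 13 G ⟩
    (t ^ G) ^ 13            ≤⟨ ^-mono-≤ 13 (^-nonneg G 0≤t) (begin
      t ^ G                   ≡⟨ sym (fromℕ-^ 2 G) ⟩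
      fromℕ (2 ℕ.^ G)         ≤⟨ fromℕ-mono (2^≤2*^ G 1≤G) ⟩
      fromℕ (2 ℕ.* G ℕ.^ G)   ≡⟨ fromℕ-* 2 (G ℕ.^ G) ⟩
      t * fromℕ (G ℕ.^ G)     ≡⟨ cong (λ q → t * q) (fromℕ-^ G G) ⟩
      t * γ ^ G               ∎) ⟩
    (t * γ ^ G) ^ 13        ≡⟨ *-^ t (γ ^ G) 13 ⟩
    t ^ 13 * (γ ^ G) ^ 13   ≡⟨ cong (λ q → t ^ 13 * q) (sym (^-* γ 13 G)) ⟩
    t ^ 13 * γ ^ (13 ℕ.* G) ∎
  σ^≤ : σ ^ (4 ℕ.* G) ≤ σ ^ (13 ℕ.* G)
  σ^≤ = begin
    σ ^ (4 ℕ.* G)                     ≡⟨ sym (ℚ.*-identityʳ _) ⟩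
    σ ^ (4 ℕ.* G) * 1ℚ                ≤⟨ ℚ.*-monoˡ-≤-nonNeg (σ ^ (4 ℕ.* G)) {{ℚ.nonNegative (^-nonneg (4 ℕ.* G) 0≤σ)}} (1≤^ (9 ℕ.* G) 1≤σ) ⟩
    σ ^ (4 ℕ.* G) * σ ^ (9 ℕ.* G)     ≡⟨ sym (^-+ σ (4 ℕ.* G) (9 ℕ.* G)) ⟩
    σ ^ (4 ℕ.* G ℕ.+ 9 ℕ.* G)         ≡⟨ cong (σ ^_) (sym (ℕ.*-distribʳ-+ G 4 9)) ⟩
    σ ^ (13 ℕ.* G)                    ∎

scaled-power-bound : ∀ {T} c X g G L Λ σ → T ℕ.≤ c ℕ.* (X ℕ.^ (4 ℕ.* g) ℕ.* 2 ℕ.^ (9 ℕ.* g) ℕ.* L) →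
  1 ℕ.≤ X → g ℕ.≤ G → L ℕ.≤ Λ → 1 ℕ.≤ G → 1ℚ ≤ σ → fromℕ X ≤ fromℕ 2 * σ →
  fromℕ T ≤ fromℕ (c ℕ.* 2 ℕ.^ 13) * ((σ * fromℕ G) ^ (13 ℕ.* G) * fromℕ Λ)
scaled-power-bound {T} c X g G L Λ σ T≤ 1≤X g≤G L≤Λ 1≤G 1≤σ X≤2σ = begin
  fromℕ T
    ≤⟨ fromℕ-mono T≤ ⟩
  fromℕ (c ℕ.* (X ℕ.^ (4 ℕ.* g) ℕ.* 2 ℕ.^ (9 ℕ.* g) ℕ.* L))
    ≤⟨ fromℕ-mono (ℕ.*-monoʳ-≤ c (ℕ.*-mono-≤ (ℕ.*-mono-≤
         (ℕ.^-monoʳ-≤ X {{ℕ.>-nonZero 1≤X}} (ℕ.*-monoʳ-≤ 4 g≤G))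
         (ℕ.^-monoʳ-≤ 2 (ℕ.*-monoʳ-≤ 9 g≤G))) L≤Λ)) ⟩
  fromℕ (c ℕ.* (X ℕ.^ (4 ℕ.* G) ℕ.* 2 ℕ.^ (9 ℕ.* G) ℕ.* Λ))
    ≡⟨ fromℕ-* c (X ℕ.^ (4 ℕ.* G) ℕ.* 2 ℕ.^ (9 ℕ.* G) ℕ.* Λ) ⟩
  fromℕ c * fromℕ (X ℕ.^ (4 ℕ.* G) ℕ.* 2 ℕ.^ (9 ℕ.* G) ℕ.* Λ)
    ≤⟨ ℚ.*-monoˡ-≤-nonNeg (fromℕ c) {{ℚ.nonNegative (0≤fromℕ c)}}
         (power-bound X G Λ σ 1≤G 1≤σ X≤2σ) ⟩
  fromℕ c * (fromℕ (2 ℕ.^ 13) * ((σ * fromℕ G) ^ (13 ℕ.* G) * fromℕ Λ))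
    ≡⟨ sym (ℚ.*-assoc (fromℕ c) (fromℕ (2 ℕ.^ 13)) _) ⟩
  fromℕ c * fromℕ (2 ℕ.^ 13) * ((σ * fromℕ G) ^ (13 ℕ.* G) * fromℕ Λ)
    ≡⟨ cong (_* ((σ * fromℕ G) ^ (13 ℕ.* G) * fromℕ Λ)) (sym (fromℕ-* c (2 ℕ.^ 13))) ⟩
  fromℕ (c ℕ.* 2 ℕ.^ 13) * ((σ * fromℕ G) ^ (13 ℕ.* G) * fromℕ Λ) ∎
  where open ℚ.≤-Reasoning

-- The three guarantees of the learner

module _ (n s : ℕ) (ε δ : ℚ) .{{_ : Positive ε}} .{{_ : Positive δ}}
         (ε<1 : ε < 1ℚ) (δ<1 : δ < 1ℚ) (f : Point n → Bool) (f∈ : f ∈DT^ s) where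

  private
    en = ∣ ↥ ε ∣
    ed = ↧ₙ ε
    dn = ∣ ↥ δ ∣
    dd = ↧ₙ δ
    a = doublings ed en ed
    e = doublings s 1 s
    j = doublings n 2 n
    L = doublings dd dn dd
    g = suc j
    G = lg n
    Λ = lg1/ δ

    1≤s : 1 ℕ.≤ s
    1≤s = ℕ.≤-trans (1≤size (proj₁ f∈)) (proj₁ (proj₂ f∈))

    1≤G : 1 ℕ.≤ G
    1≤G = ℕ.m≤m⊔n 1 ⌈log₂ n ⌉

    -- L = 0 would mean an empty sample. It is excluded by δ < 1, because it would put the
    -- denominator of δ below or at its numerator.
    1≤L : 1 ℕ.≤ L
    1≤L with L in eq
    ... | suc _ = s≤s z≤n
    ... | zero  = ⊥-elim (ℕ.<⇒≱ (numerator<denominator δ δ<1)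
      (subst (dd ℕ.≤_) (trans (cong (λ k → 2 ℕ.^ k ℕ.* dn) eq) (ℕ.+-identityʳ dn))
        (doublings-enough dn dd (0<numerator δ))))

    2^a≤2/ε : fromℕ (2 ℕ.^ a) ≤ fromℕ 2 * inv ε
    2^a≤2/ε = ≤*inv ε (2 ℕ.^ a) 2 (doublings-upper ed en ed
      (ℕ.≤-trans (ℕ.<⇒≤ (numerator<denominator ε ε<1)) (ℕ.m≤m+n ed _)))

    1≤σ : 1ℚ ≤ fromℕ s * inv ε
    1≤σ = ≤*inv ε 1 s (ℕ.*-mono-≤ 1≤s (ℕ.<⇒≤ (numerator<denominator ε ε<1)))

    draws = learner-draws f s en ed dn dd

  -- The constant is 2 · 7 from the sample size, times 2 for rounding 1/ε up to a power of two.
  queries-bound : ∀ ω → fromℕ (queries (run learner f s ε δ) ω)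
    ≤ fromℕ 28 * (inv ε * fromℕ s * fromℕ G * fromℕ Λ)
  queries-bound ω = begin
    fromℕ (queries (run learner f s ε δ) ω)
      ≡⟨ cong fromℕ (queries-drawn draws ω) ⟩
    fromℕ (2 ℕ.* 2 ℕ.^ a ℕ.* (7 ℕ.* (s ℕ.* (g ℕ.* L))))
      ≡⟨ cong fromℕ (lem₁ (2 ℕ.^ a) (s ℕ.* (g ℕ.* L))) ⟩
    fromℕ (14 ℕ.* 2 ℕ.^ a ℕ.* (s ℕ.* (g ℕ.* L)))
      ≤⟨ fromℕ-mono (ℕ.*-monoʳ-≤ (14 ℕ.* 2 ℕ.^ a)
           (ℕ.*-monoʳ-≤ s (ℕ.*-mono-≤ (log-n≤lg n) (confidence≤lg1/ δ)))) ⟩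
    fromℕ (14 ℕ.* 2 ℕ.^ a ℕ.* (s ℕ.* (G ℕ.* Λ)))
      ≡⟨ trans (fromℕ-* (14 ℕ.* 2 ℕ.^ a) (s ℕ.* (G ℕ.* Λ)))
           (cong₂ _*_ (fromℕ-* 14 (2 ℕ.^ a)) (trans (fromℕ-* s (G ℕ.* Λ)) (cong (λ q → fromℕ s * q) (fromℕ-* G Λ)))) ⟩
    fromℕ 14 * fromℕ (2 ℕ.^ a) * (fromℕ s * (fromℕ G * fromℕ Λ))
      ≤⟨ ℚ.*-monoʳ-≤-nonNeg (fromℕ s * (fromℕ G * fromℕ Λ))
           {{ℚ.nonNegative (*-nonneg (0≤fromℕ s) (*-nonneg (0≤fromℕ G) (0≤fromℕ Λ)))}}
           (ℚ.*-monoˡ-≤-nonNeg (fromℕ 14) {{ℚ.nonNegative (0≤fromℕ 14)}} 2^a≤2/ε) ⟩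
    fromℕ 14 * (fromℕ 2 * inv ε) * (fromℕ s * (fromℕ G * fromℕ Λ))
      ≡⟨ lem₂ (fromℕ 14) (fromℕ 2) (inv ε) (fromℕ s) (fromℕ G) (fromℕ Λ) ⟩
    fromℕ 14 * fromℕ 2 * (inv ε * fromℕ s * fromℕ G * fromℕ Λ)
      ≡⟨ cong (_* (inv ε * fromℕ s * fromℕ G * fromℕ Λ)) (sym (fromℕ-* 14 2)) ⟩
    fromℕ 28 * (inv ε * fromℕ s * fromℕ G * fromℕ Λ) ∎
    where
    open ℚ.≤-Reasoning
    lem₁ : ∀ q x → 2 ℕ.* q ℕ.* (7 ℕ.* x) ≡ 14 ℕ.* q ℕ.* x
    lem₁ = solve-∀
    lem₂ : ∀ a b i s g l → a * (b * i) * (s * (g * l)) ≡ a * b * (i * s * g * l)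
    lem₂ = Ring.solve-∀ ℚ-ring

  time-bound : ∀ ω → fromℕ (time (run learner f s ε δ) ω)
    ≤ fromℕ (1444 ℕ.* 2 ℕ.^ 13) * ((fromℕ s * inv ε * fromℕ G) ^ (13 ℕ.* G) * fromℕ Λ)
  time-bound ω = scaled-power-bound 1444 (2 ℕ.^ a ℕ.* s) g G L Λ (fromℕ s * inv ε)
    (ℕ.≤-trans (time-drawn draws ω) (total-time-≤ n s a e j L 1≤s 1≤L (n≤2^log-n n) 2^e≤2s))
    (ℕ.*-mono-≤ (ℕ.m^n>0 2 a) 1≤s) (log-n≤lg n) (confidence≤lg1/ δ) 1≤G 1≤σ X≤2σ
    where
    open ℚ.≤-Reasoning
    2^e≤2s : 2 ℕ.^ e ℕ.≤ 2 ℕ.* s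
    2^e≤2s = ℕ.≤-trans (ℕ.≤-reflexive (sym (ℕ.*-identityʳ (2 ℕ.^ e))))
      (doublings-upper s 1 s (ℕ.≤-trans 1≤s (ℕ.m≤m+n s _)))
    lem : ∀ t i s → t * i * s ≡ t * (s * i)
    lem = Ring.solve-∀ ℚ-ring
    X≤2σ : fromℕ (2 ℕ.^ a ℕ.* s) ≤ fromℕ 2 * (fromℕ s * inv ε)
    X≤2σ = begin
      fromℕ (2 ℕ.^ a ℕ.* s)         ≡⟨ fromℕ-* (2 ℕ.^ a) s ⟩
      fromℕ (2 ℕ.^ a) * fromℕ s     ≤⟨ ℚ.*-monoʳ-≤-nonNeg (fromℕ s) {{ℚ.nonNegative (0≤fromℕ s)}} 2^a≤2/ε ⟩
      fromℕ 2 * inv ε * fromℕ s     ≡⟨ lem (fromℕ 2) (inv ε) (fromℕ s) ⟩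
      fromℕ 2 * (fromℕ s * inv ε)   ∎

  -- The tolerance is ν = 2^-(1+a), half of the power of two to which ε is rounded down. The e
  -- further levels of depth compensate for the factor s in the probability of a deep path.
  success : 1ℚ - δ ≤ Pr (run learner f s ε δ) (good? f s ε)
  success = begin
    1ℚ - δ                       ≤⟨ ℚ.+-monoˡ-≤ (- δ) (ℚ.≤-trans
                                      (learner-succeeds {d = 1 ℕ.+ a ℕ.+ e} f∈ s/2^d≤ν 2ν≤ε (0≤1-½^ (suc a)) draws)
                                      (ℚ.+-monoʳ-≤ Q failure≤δ)) ⟩
    Q + δ - δ                    ≡⟨ lem Q δ ⟩
    Q                            ∎
    where
    open ℚ.≤-Reasoning
    Q : ℚ
    Q = Pr (run learner f s ε δ) (good? f s ε)
    lem : ∀ q d → q + d - d ≡ q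
    lem = Ring.solve-∀ ℚ-ring
    failure≤δ : (1ℚ - ½ ^ suc a) ^ sample-size f s en ed dn dd * fromℕ ((3 ℕ.+ n) ℕ.^ (2 ℕ.* s)) ≤ δ
    failure≤δ = ℚ.≤-trans (failure-probability (suc a) n s g L 1≤s (n≤2^log-n n) (s≤s z≤n) 1≤L)
      (½^≤ δ L (doublings-enough dn dd (0<numerator δ)))
    2ν≤ε : ½ ^ suc a + ½ ^ suc a ≤ ε
    2ν≤ε = ℚ.≤-trans
      (ℚ.≤-reflexive (trans (sym (ℚ.*-distribˡ-+ ½ (½ ^ a) (½ ^ a))) (average (½ ^ a))))
      (½^≤ ε a (doublings-enough en ed (0<numerator ε)))
    s/2^d≤ν : fromℕ s * ½ ^ (1 ℕ.+ a ℕ.+ e) ≤ ½ ^ suc a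
    s/2^d≤ν = begin
      fromℕ s * ½ ^ (1 ℕ.+ a ℕ.+ e)
        ≤⟨ ℚ.*-monoʳ-≤-nonNeg (½ ^ (1 ℕ.+ a ℕ.+ e)) {{ℚ.nonNegative (^-nonneg (1 ℕ.+ a ℕ.+ e) 0≤½)}}
             (fromℕ-mono (subst (s ℕ.≤_) (ℕ.*-identityʳ (2 ℕ.^ e)) (doublings-enough 1 s (s≤s z≤n)))) ⟩
      fromℕ (2 ℕ.^ e) * ½ ^ (1 ℕ.+ a ℕ.+ e)
        ≡⟨ cong (λ q → fromℕ (2 ℕ.^ e) * q) (^-+ ½ (1 ℕ.+ a) e) ⟩
      fromℕ (2 ℕ.^ e) * (½ ^ suc a * ½ ^ e)
        ≡⟨ lem₁ (fromℕ (2 ℕ.^ e)) (½ ^ suc a) (½ ^ e) ⟩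
      ½ ^ suc a * (fromℕ (2 ℕ.^ e) * ½ ^ e)
        ≡⟨ cong (λ q → ½ ^ suc a * q) (2^k*½^k≡1 e) ⟩
      ½ ^ suc a * 1ℚ
        ≡⟨ ℚ.*-identityʳ (½ ^ suc a) ⟩
      ½ ^ suc a ∎
      where
      lem₁ : ∀ x y z → x * (y * z) ≡ y * (x * z)
      lem₁ = Ring.solve-∀ ℚ-ring

mainTheorem9 : Σ[ A ∈ Learner ] Σ[ c₁ ∈ ℕ ] Σ[ c₂ ∈ ℕ ] Σ[ c₃ ∈ ℕ ]
    ((n s : ℕ) (ε δ : ℚ) .{{_ : Positive ε}} .{{_ : Positive δ}} →
    ε < 1ℚ → δ < 1ℚ →
    (f : Point n → Bool) → f ∈DT^ s →
    ((ω : ℕ → Point n) →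
    fromℕ (queries (run A f s ε δ) ω)
    ≤ fromℕ c₁ * (inv ε * fromℕ s * fromℕ (lg n) * fromℕ (lg1/ δ)))
    × ((ω : ℕ → Point n) →
    fromℕ (time (run A f s ε δ) ω)
    ≤ fromℕ c₂ * ((fromℕ s * inv ε * fromℕ (lg n)) ^ (c₃ ℕ.* lg n) * fromℕ (lg1/ δ)))
    × 1ℚ - δ ≤ Pr (run A f s ε δ) (good? f s ε))
mainTheorem9 = learner , 28 , 1444 ℕ.* 2 ℕ.^ 13 , 13 , λ n s ε δ ε<1 δ<1 f f∈ →
  queries-bound n s ε δ ε<1 δ<1 f f∈ , time-bound n s ε δ ε<1 δ<1 f f∈ , success n s ε δ ε<1 δ<1 f f∈
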